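{- Every box-integer polyhedron $P \subseteq \mathbb{R}^n$ can be represented as a Minkowski sum $P = Q + C = \{q + c \mid q \in Q,\ c \in C\}$ with a bounded box-integer polyhedron $Q$ and a box-integer polyhedral cone $C$.
   Context: All polyhedra are assumed nonempty. A polyhedron $P$ is an integer polyhedron if $P$ equals the convex hull of $P \cap \mathbb{Z}^n$. A polyhedron $P \subseteq \mathbb{R}^n$ is box-integer if $P \cap \{x \in \mathbb{R}^n \mid l \le x \le u\}$ is an integer polyhedron for every choice of integer vectors $l,u \in \mathbb{Z}^n$ with $l \le u$. A cone is a set $C$ with $\lambda d \in C$ whenever $d \in C$ and $\lambda \ge 0$.
   Formalization: The polyhedra are taken in rational space instead of real space: the inequalities defining P, Q and C have rational coefficients, and points, convex weights and cone scalars are rational; convex hulls and the Minkowski sum are sets of rational points. -}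

module Defs where

open import Data.Nat using (ℕ; zero; suc)
open import Data.Fin using (Fin; zero; suc)
open import Data.Integer as ℤ using (ℤ)
open import Data.Rational using (ℚ; _+_; _*_; _≤_; 0ℚ; 1ℚ; _/_; ∣_∣)
open import Data.Product using (Σ; ∃; _×_; _,_)
open import Relation.Binary.PropositionalEquality using (_≡_)
open import Function.Bundles using (_⇔_)

Point : ℕ → Set
Point n = Fin n → ℚ

Σᶠ : (k : ℕ) → (Fin k → ℚ) → ℚ
Σᶠ zero    f = 0ℚ
Σᶠ (suc k) f = f zero + Σᶠ k (λ i → f (suc i))

dot : {n : ℕ} → Point n → Point n → ℚ
dot {n} a x = Σᶠ n (λ j → a j * x j)

record Polyhedron (n : ℕ) : Set where
  field
    m : ℕ
    A : Fin m → Point n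
    b : Fin m → ℚ

_∈P_ : {n : ℕ} → Point n → Polyhedron n → Set
x ∈P P = ∀ (i : Fin (Polyhedron.m P)) → dot (Polyhedron.A P i) x ≤ Polyhedron.b P i

Nonempty : {n : ℕ} → Polyhedron n → Set
Nonempty {n} P = Σ (Point n) λ x → x ∈P P

fromℤ : ℤ → ℚ
fromℤ z = z / 1

IsIntegral : {n : ℕ} → Point n → Set
IsIntegral {n} x = ∀ (j : Fin n) → Σ ℤ λ z → x j ≡ fromℤ z

ConvHull : {n : ℕ} → (Point n → Set) → Point n → Set
ConvHull {n} S x =
  Σ ℕ λ k → Σ (Fin k → Point n) λ z → Σ (Fin k → ℚ) λ lam →
    (∀ i → 0ℚ ≤ lam i) × (Σᶠ k lam ≡ 1ℚ) × (∀ i → S (z i)) ×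
    (∀ (j : Fin n) → x j ≡ Σᶠ k (λ i → lam i * z i j))

IntegerSet : {n : ℕ} → (Point n → Set) → Set
IntegerSet {n} S = ∀ (x : Point n) → S x ⇔ ConvHull (λ y → S y × IsIntegral y) x

IsIntegerPolyhedron : {n : ℕ} → Polyhedron n → Set
IsIntegerPolyhedron P = IntegerSet (λ x → x ∈P P)

IsBoxInteger : {n : ℕ} → Polyhedron n → Set
IsBoxInteger {n} P =
  ∀ (l u : Fin n → ℤ) → (∀ j → l j ℤ.≤ u j) →
    IntegerSet (λ x → (x ∈P P) × (∀ j → (fromℤ (l j) ≤ x j) × (x j ≤ fromℤ (u j))))

Bounded : {n : ℕ} → Polyhedron n → Set
Bounded {n} P = Σ ℚ λ M → ∀ (x : Point n) → x ∈P P → ∀ j → ∣ x j ∣ ≤ M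

IsCone : {n : ℕ} → Polyhedron n → Set
IsCone {n} C = ∀ (d : Point n) → d ∈P C → ∀ (t : ℚ) → 0ℚ ≤ t → (λ j → t * d j) ∈P C

IsMinkowskiSum : {n : ℕ} → Polyhedron n → Polyhedron n → Polyhedron n → Set
IsMinkowskiSum {n} P Q C =
  ∀ (x : Point n) → (x ∈P P) ⇔
    (Σ (Point n) λ q → Σ (Point n) λ c → (q ∈P Q) × (c ∈P C) × (∀ j → x j ≡ q j + c j))

{-# OPTIONS --safe #-}
-- Let C be the recession cone of P = {x | Ax ≤ b}, and Q the intersection of P with a large integer box.
-- The double description method, applied to the homogenization of P, gives P = Q + C, and Q inherits
-- box-integrality from P.  For C, take x in C ∩ [l,u].  For integral p in P, the point p + x is a convex
-- combination of integral points z of P in p + [⌊x⌋,⌈x⌉].  The rows tight at x vanish on average on the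
-- differences z − p, so either they all vanish on some w = z − p, or some z has lexicographically smaller
-- slacks in these rows than p and may replace p.  If x is not integral, moving from x in the directions
-- ±(w − x) until another row or coordinate of the box gets tight writes x as a convex combination of two
-- points with more tight constraints.
module Submission where

open import Defs
open import Data.Nat.Base as ℕ using (ℕ; zero; suc; s≤s; z≤n)
import Data.Nat.Properties as ℕ
import Data.Nat.Induction as ℕ
open import Data.Fin.Base using (Fin; zero; suc; _↑ˡ_; _↑ʳ_; splitAt; join)
open import Data.Fin.Properties using (splitAt-join; any?; all?; ¬∀⟶∃¬)
open import Data.Integer.Base as ℤ using (ℤ; 0ℤ; 1ℤ; +≤+)
import Data.Integer.Properties as ℤ
import Data.Integer.DivMod as ℤ
open import Data.Rational.Base hiding (_/_)
open import Data.Rational.Properties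
open import Data.Rational.Unnormalised.Base as ℚᵘ using (mkℚᵘ)
import Data.Rational.Unnormalised.Properties as ℚᵘ
open import Data.Maybe.Base using (Maybe; just; nothing)
open import Data.Product using (Σ; ∃; ∃₂; _×_; _,_; proj₁; proj₂)
open import Data.Sum.Base as Sum using (_⊎_; inj₁; inj₂; [_,_]′)
open import Data.Empty using (⊥)
open import Data.List.Base as List using (List; []; _∷_; filter; cartesianProductWith)
open import Data.List.Membership.Propositional using (_∈_)
open import Data.List.Membership.Propositional.Properties
  using (∈-filter⁺; ∈-filter⁻; ∈-++⁺ˡ; ∈-++⁺ʳ; ∈-++⁻; ∈-cartesianProductWith⁺; ∈-cartesianProductWith⁻; ∈-map⁺)
open import Data.List.Relation.Unary.Any using (here; there)
open import Data.Vec.Base using (Vec; tabulate)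
import Data.Vec.Functional as Vector
open import Data.Vec.Relation.Binary.Lex.Strict as Lex using (Lex-<; this; next)
open import Function.Base using (_∘_; _$_)
open import Function.Bundles using (mk⇔; Equivalence)
open import Induction.WellFounded using (WellFounded; Acc; acc)
open import Relation.Binary.Definitions using (tri<; tri≈; tri>)
open import Relation.Binary.PropositionalEquality
open import Relation.Nullary using (Dec; yes; no; ¬_; contradiction)
open import Relation.Nullary.Decidable using (_×-dec_)
open import Tactic.RingSolver using (solve-∀)
open import Tactic.RingSolver.Core.AlmostCommutativeRing using (AlmostCommutativeRing; fromCommutativeRing)

-- Box-integrality says something about `P` only, and `P` around p + x is in general larger than p +
-- C: a row that is tight at x may be slack at p, so the differences z - p can leave C. The vector w
-- is therefore not asked to lie in C. It has to vanish on the rows tight at x and to stay in the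
-- integer box around x, and it serves only to give the direction w - x. Along this direction all
-- tight rows are constant, the integral coordinates included, so both signs are admissible for a
-- short step; that w differs from x at every fractional coordinate makes the direction nonzero. The
-- order on p has to be lexicographic. The sum of the slacks in the tight rows can be the same at p
-- and at all z while single rows still grow or shrink, whereas comparing row by row leaves some z
-- on which all these rows agree with p once no improvement is possible.

ℚ-ring : AlmostCommutativeRing _ _
ℚ-ring = fromCommutativeRing +-*-commutativeRing isZero
  where
  isZero : ∀ x → Maybe (0ℚ ≡ x)
  isZero x with 0ℚ ≟ x
  ... | yes p = just p
  ... | no  _ = nothing

-- Rational arithmetic and inequalities

neg-involutive : ∀ p → - - p ≡ p
neg-involutive = solve-∀ ℚ-ring

≤⇒0≤- : ∀ {p q} → p ≤ q → 0ℚ ≤ q - p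
≤⇒0≤- {p} {q} p≤q = subst (_≤ q - p) (+-inverseʳ p) (+-monoˡ-≤ (- p) p≤q)

-- The form in which inequalities are certified below: a ring identity rewrites the difference as an
-- expression `e` whose nonnegativity is visible from its shape.
0≤-⇒≤ : ∀ {p q} e → 0ℚ ≤ e → q - p ≡ e → p ≤ q
0≤-⇒≤ {p} {q} e 0≤e eq =
  subst₂ _≤_ (+-identityʳ p) (lemma p q) (+-monoʳ-≤ p (subst (0ℚ ≤_) (sym eq) 0≤e))
  where
  lemma : ∀ p q → p + (q - p) ≡ q
  lemma = solve-∀ ℚ-ring

0≤+ : ∀ {p q} → 0ℚ ≤ p → 0ℚ ≤ q → 0ℚ ≤ p + q
0≤+ {p} {q} 0≤p 0≤q = subst (_≤ p + q) (+-identityˡ 0ℚ) (+-mono-≤ 0≤p 0≤q)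

0≤* : ∀ {p q} → 0ℚ ≤ p → 0ℚ ≤ q → 0ℚ ≤ p * q
0≤* {p} {q} 0≤p 0≤q =
  subst (_≤ p * q) (*-zeroʳ p) (*-monoˡ-≤-nonNeg p {{nonNegative 0≤p}} 0≤q)

0<* : ∀ {p q} → 0ℚ < p → 0ℚ < q → 0ℚ < p * q
0<* {p} {q} 0<p 0<q =
  subst (_< p * q) (*-zeroʳ p) (*-monoʳ-<-pos p {{positive 0<p}} 0<q)

≤0⇒0≤neg : ∀ {p} → p ≤ 0ℚ → 0ℚ ≤ - p
≤0⇒0≤neg {p} p≤0 = neg-antimono-≤ p≤0

reciprocal : ∀ {t} → 0ℚ < t → ∃ λ s → 0ℚ < s × s * t ≡ 1ℚ
reciprocal {t} 0<t = 1/ t , positive⁻¹ (1/ t) {{1/pos⇒pos t}} , *-inverseˡ t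
  where instance
  t-pos : Positive t
  t-pos = positive 0<t
  t-nonZero : NonZero t
  t-nonZero = pos⇒nonZero t

-- Integers among the rationals, floors and ceilings

toℚᵘ-fromℤ : ∀ z → toℚᵘ (fromℤ z) ℚᵘ.≃ mkℚᵘ z 0
toℚᵘ-fromℤ z = toℚᵘ-fromℚᵘ (mkℚᵘ z 0)

fromℤ-+ : ∀ y z → fromℤ (y ℤ.+ z) ≡ fromℤ y + fromℤ z
fromℤ-+ y z = toℚᵘ-injective (begin
  toℚᵘ (fromℤ (y ℤ.+ z))                ≈⟨ toℚᵘ-fromℤ (y ℤ.+ z) ⟩
  mkℚᵘ (y ℤ.+ z) 0                      ≈⟨ ℚᵘ.*≡* (cong (ℤ._* 1ℤ) (sym (cong₂ ℤ._+_ (ℤ.*-identityʳ y) (ℤ.*-identityʳ z)))) ⟩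
  mkℚᵘ y 0 ℚᵘ.+ mkℚᵘ z 0                ≈⟨ ℚᵘ.+-cong (toℚᵘ-fromℤ y) (toℚᵘ-fromℤ z) ⟨
  toℚᵘ (fromℤ y) ℚᵘ.+ toℚᵘ (fromℤ z)    ≈⟨ toℚᵘ-homo-+ (fromℤ y) (fromℤ z) ⟨
  toℚᵘ (fromℤ y + fromℤ z)              ∎)
  where open ℚᵘ.≃-Reasoning

fromℤ-* : ∀ y z → fromℤ (y ℤ.* z) ≡ fromℤ y * fromℤ z
fromℤ-* y z = toℚᵘ-injective (begin
  toℚᵘ (fromℤ (y ℤ.* z))                ≈⟨ toℚᵘ-fromℤ (y ℤ.* z) ⟩
  mkℚᵘ (y ℤ.* z) 0                      ≈⟨ ℚᵘ.*≡* refl ⟩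
  mkℚᵘ y 0 ℚᵘ.* mkℚᵘ z 0                ≈⟨ ℚᵘ.*-cong (toℚᵘ-fromℤ y) (toℚᵘ-fromℤ z) ⟨
  toℚᵘ (fromℤ y) ℚᵘ.* toℚᵘ (fromℤ z)    ≈⟨ toℚᵘ-homo-* (fromℤ y) (fromℤ z) ⟨
  toℚᵘ (fromℤ y * fromℤ z)              ∎)
  where open ℚᵘ.≃-Reasoning

fromℤ-neg : ∀ z → fromℤ (ℤ.- z) ≡ - fromℤ z
fromℤ-neg z = toℚᵘ-injective (begin
  toℚᵘ (fromℤ (ℤ.- z))    ≈⟨ toℚᵘ-fromℤ (ℤ.- z) ⟩
  ℚᵘ.- mkℚᵘ z 0           ≈⟨ ℚᵘ.-‿cong (toℚᵘ-fromℤ z) ⟨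
  ℚᵘ.- toℚᵘ (fromℤ z)     ≈⟨ toℚᵘ-homo‿- (fromℤ z) ⟨
  toℚᵘ (- fromℤ z)        ∎)
  where open ℚᵘ.≃-Reasoning

fromℤ-mono-≤ : ∀ {y z} → y ℤ.≤ z → fromℤ y ≤ fromℤ z
fromℤ-mono-≤ {y} {z} y≤z = toℚᵘ-cancel-≤
  (ℚᵘ.≤-respʳ-≃ (ℚᵘ.≃-sym (toℚᵘ-fromℤ z))
    (ℚᵘ.≤-respˡ-≃ (ℚᵘ.≃-sym (toℚᵘ-fromℤ y)) (ℚᵘ.*≤* (ℤ.*-monoʳ-≤-nonNeg 1ℤ y≤z))))

fromℤ-cancel-≤ : ∀ {y z} → fromℤ y ≤ fromℤ z → y ℤ.≤ z
fromℤ-cancel-≤ {y} {z} y≤z =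
  subst₂ ℤ._≤_ (ℤ.*-identityʳ y) (ℤ.*-identityʳ z) (ℚᵘ.drop-*≤*
    (ℚᵘ.≤-respʳ-≃ (toℚᵘ-fromℤ z) (ℚᵘ.≤-respˡ-≃ (toℚᵘ-fromℤ y) (toℚᵘ-mono-≤ y≤z))))

floor-≤ : ∀ q → fromℤ (floor q) ≤ q
floor-≤ q@(mkℚ n d-1 _) = toℚᵘ-cancel-≤
  (ℚᵘ.≤-respˡ-≃ (ℚᵘ.≃-sym (toℚᵘ-fromℤ (floor q)))
    (ℚᵘ.*≤* (subst (floor q ℤ.* ℤ.+ suc d-1 ℤ.≤_) (sym (ℤ.*-identityʳ n)) (ℤ.[n/d]*d≤n n (ℤ.+ suc d-1)))))

<-suc-floor : ∀ q → q < fromℤ (ℤ.suc (floor q))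
<-suc-floor q@(mkℚ n d-1 _) = toℚᵘ-cancel-<
  (ℚᵘ.<-respʳ-≃ (ℚᵘ.≃-sym (toℚᵘ-fromℤ (ℤ.suc (floor q))))
    (ℚᵘ.*<* (subst₂ ℤ._<_ (sym (ℤ.*-identityʳ n))
      (cong (λ z → ℤ.suc z ℤ.* ℤ.+ suc d-1) (sym (ℤ.div-pos-is-/ℕ n (suc d-1))))
      (ℤ.n<s[n/ℕd]*d n (suc d-1)))))

floor-greatest : ∀ {z q} → fromℤ z ≤ q → z ℤ.≤ floor q
floor-greatest {z} {q} z≤q with z ℤ.≤? floor q
... | yes p = p
... | no ¬p = contradiction
  (<-≤-trans (<-suc-floor q) (≤-trans (fromℤ-mono-≤ (ℤ.i<j⇒suc[i]≤j (ℤ.≰⇒> ¬p))) z≤q))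
  (<-irrefl refl)

ceiling-neg-floor : ∀ q → ceiling q ≡ ℤ.- floor (- q)
ceiling-neg-floor (mkℚ _ _ _) = refl

≤-ceiling : ∀ q → q ≤ fromℤ (ceiling q)
≤-ceiling q rewrite ceiling-neg-floor q | fromℤ-neg (floor (- q)) =
  subst (_≤ - fromℤ (floor (- q))) (neg-involutive q) (neg-antimono-≤ (floor-≤ (- q)))

ceiling-least : ∀ {z q} → q ≤ fromℤ z → ceiling q ℤ.≤ z
ceiling-least {z} {q} q≤z rewrite ceiling-neg-floor q =
  subst (ℤ.- floor (- q) ℤ.≤_) (ℤ.neg-involutive z)
    (ℤ.neg-mono-≤ (floor-greatest (subst (_≤ - q) (sym (fromℤ-neg z)) (neg-antimono-≤ q≤z))))

Integral : ℚ → Set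
Integral q = Σ ℤ λ z → q ≡ fromℤ z

integral-+ : ∀ {p q} → Integral p → Integral q → Integral (p + q)
integral-+ (y , refl) (z , refl) = y ℤ.+ z , sym (fromℤ-+ y z)

integral-* : ∀ {p q} → Integral p → Integral q → Integral (p * q)
integral-* (y , refl) (z , refl) = y ℤ.* z , sym (fromℤ-* y z)

integral⇒floor : ∀ {q} → Integral q → q ≡ fromℤ (floor q)
integral⇒floor {q} (z , refl) =
  ≤-antisym (fromℤ-mono-≤ (floor-greatest {z} ≤-refl)) (floor-≤ q)

integral⇒ceiling : ∀ {q} → Integral q → q ≡ fromℤ (ceiling q)
integral⇒ceiling {q} (z , refl) =
  ≤-antisym (≤-ceiling q) (fromℤ-mono-≤ (ceiling-least {z} ≤-refl))

integral? : ∀ q → Dec (Integral q)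
integral? q with q ≟ fromℤ (floor q)
... | yes q≡⌊q⌋ = yes (floor q , q≡⌊q⌋)
... | no  q≢⌊q⌋ = no (q≢⌊q⌋ ∘ integral⇒floor)

-- Finite sums, points and scalar products

Σᶠ-cong : ∀ k {f g : Fin k → ℚ} → (∀ i → f i ≡ g i) → Σᶠ k f ≡ Σᶠ k g
Σᶠ-cong zero    eq = refl
Σᶠ-cong (suc k) eq = cong₂ _+_ (eq zero) (Σᶠ-cong k (eq ∘ suc))

Σᶠ-linear : ∀ k s t (f g : Fin k → ℚ) →
  Σᶠ k (λ i → s * f i + t * g i) ≡ s * Σᶠ k f + t * Σᶠ k g
Σᶠ-linear zero    s t f g = lemma s t
  where
  lemma : ∀ s t → 0ℚ ≡ s * 0ℚ + t * 0ℚ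
  lemma = solve-∀ ℚ-ring
Σᶠ-linear (suc k) s t f g =
  trans (cong (s * f zero + t * g zero +_) (Σᶠ-linear k s t (f ∘ suc) (g ∘ suc)))
        (lemma s t (f zero) (g zero) (Σᶠ k (f ∘ suc)) (Σᶠ k (g ∘ suc)))
  where
  lemma : ∀ s t x y X Y → s * x + t * y + (s * X + t * Y) ≡ s * (x + X) + t * (y + Y)
  lemma = solve-∀ ℚ-ring

Σᶠ-zero : ∀ k {f : Fin k → ℚ} → (∀ i → f i ≡ 0ℚ) → Σᶠ k f ≡ 0ℚ
Σᶠ-zero zero    eq = refl
Σᶠ-zero (suc k) eq = trans (cong₂ _+_ (eq zero) (Σᶠ-zero k (eq ∘ suc))) (+-identityˡ 0ℚ)

Σᶠ-scale : ∀ k t (f : Fin k → ℚ) → Σᶠ k (λ i → t * f i) ≡ t * Σᶠ k f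
Σᶠ-scale zero    t f = sym (*-zeroʳ t)
Σᶠ-scale (suc k) t f = trans (cong (t * f zero +_) (Σᶠ-scale k t (f ∘ suc)))
                             (sym (*-distribˡ-+ t (f zero) _))

Σᶠ-mono-≤ : ∀ k {f g : Fin k → ℚ} → (∀ i → f i ≤ g i) → Σᶠ k f ≤ Σᶠ k g
Σᶠ-mono-≤ zero    f≤g = ≤-refl
Σᶠ-mono-≤ (suc k) f≤g = +-mono-≤ (f≤g zero) (Σᶠ-mono-≤ k (f≤g ∘ suc))

Σᶠ-++ : ∀ k l (f : Fin (k ℕ.+ l) → ℚ) →
  Σᶠ (k ℕ.+ l) f ≡ Σᶠ k (λ i → f (i ↑ˡ l)) + Σᶠ l (λ i → f (k ↑ʳ i))
Σᶠ-++ zero    l f = sym (+-identityˡ _)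
Σᶠ-++ (suc k) l f = trans (cong (f zero +_) (Σᶠ-++ k l (f ∘ suc))) (sym (+-assoc (f zero) _ _))

Σᶠ-swap : ∀ k l (f : Fin k → Fin l → ℚ) →
  Σᶠ k (λ i → Σᶠ l (f i)) ≡ Σᶠ l (λ j → Σᶠ k (λ i → f i j))
Σᶠ-swap zero    l f = sym (Σᶠ-zero l λ _ → refl)
Σᶠ-swap (suc k) l f = begin
  Σᶠ l (f zero) + Σᶠ k (λ i → Σᶠ l (f (suc i)))
    ≡⟨ cong (Σᶠ l (f zero) +_) (Σᶠ-swap k l (f ∘ suc)) ⟩
  Σᶠ l (f zero) + Σᶠ l rest
    ≡⟨ cong₂ _+_ (*-identityˡ (Σᶠ l (f zero))) (*-identityˡ (Σᶠ l rest)) ⟨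
  1ℚ * Σᶠ l (f zero) + 1ℚ * Σᶠ l rest
    ≡⟨ Σᶠ-linear l 1ℚ 1ℚ (f zero) rest ⟨
  Σᶠ l (λ j → 1ℚ * f zero j + 1ℚ * rest j)
    ≡⟨ Σᶠ-cong l (λ j → cong₂ _+_ (*-identityˡ (f zero j)) (*-identityˡ (rest j))) ⟩
  Σᶠ l (λ j → f zero j + rest j) ∎
  where
  open ≡-Reasoning
  rest : Fin l → ℚ
  rest j = Σᶠ k (λ i → f (suc i) j)

infix 4 _≐_
_≐_ : ∀ {n} → Point n → Point n → Set
x ≐ y = ∀ j → x j ≡ y j

infixl 6 _⊕_
infixr 7 _⊙_

_⊕_ : ∀ {n} → Point n → Point n → Point n
(x ⊕ y) j = x j + y j

_⊙_ : ∀ {n} → ℚ → Point n → Point n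
(t ⊙ x) j = t * x j

𝟎 : ∀ {n} → Point n
𝟎 _ = 0ℚ

dot-cong : ∀ {n} (a : Point n) {x y} → x ≐ y → dot a x ≡ dot a y
dot-cong a x≐y = Σᶠ-cong _ (λ j → cong (a j *_) (x≐y j))

dot-linear : ∀ {n} (a : Point n) s t x y → dot a (s ⊙ x ⊕ t ⊙ y) ≡ s * dot a x + t * dot a y
dot-linear {n} a s t x y =
  trans (Σᶠ-cong n λ j → lemma s t (a j) (x j) (y j))
        (Σᶠ-linear n s t (λ j → a j * x j) (λ j → a j * y j))
  where
  lemma : ∀ s t a x y → a * (s * x + t * y) ≡ s * (a * x) + t * (a * y)
  lemma = solve-∀ ℚ-ring

dot-⊕ : ∀ {n} (a : Point n) x y → dot a (x ⊕ y) ≡ dot a x + dot a y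
dot-⊕ a x y = begin
  dot a (x ⊕ y)               ≡⟨ dot-cong a (λ j → cong₂ _+_ (*-identityˡ (x j)) (*-identityˡ (y j))) ⟨
  dot a (1ℚ ⊙ x ⊕ 1ℚ ⊙ y)     ≡⟨ dot-linear a 1ℚ 1ℚ x y ⟩
  1ℚ * dot a x + 1ℚ * dot a y ≡⟨ cong₂ _+_ (*-identityˡ (dot a x)) (*-identityˡ (dot a y)) ⟩
  dot a x + dot a y           ∎
  where open ≡-Reasoning

dot-⊙ : ∀ {n} (a : Point n) t x → dot a (t ⊙ x) ≡ t * dot a x
dot-⊙ {n} a t x =
  trans (Σᶠ-cong n λ j → lemma t (a j) (x j)) (Σᶠ-scale n t (λ j → a j * x j))
  where
  lemma : ∀ t a x → a * (t * x) ≡ t * (a * x)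
  lemma = solve-∀ ℚ-ring

dot-𝟎 : ∀ {n} (a : Point n) → dot a 𝟎 ≡ 0ℚ
dot-𝟎 a = Σᶠ-zero _ λ j → *-zeroʳ (a j)

dot-Σᶠ : ∀ {n k} (a : Point n) (lam : Fin k → ℚ) (z : Fin k → Point n) →
  dot a (λ j → Σᶠ k (λ i → lam i * z i j)) ≡ Σᶠ k (λ i → lam i * dot a (z i))
dot-Σᶠ {n} {k} a lam z = begin
  Σᶠ n (λ j → a j * Σᶠ k (λ i → lam i * z i j))   ≡⟨ Σᶠ-cong n (λ j → Σᶠ-scale k (a j) (λ i → lam i * z i j)) ⟨
  Σᶠ n (λ j → Σᶠ k (λ i → a j * (lam i * z i j))) ≡⟨ Σᶠ-swap n k (λ j i → a j * (lam i * z i j)) ⟩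
  Σᶠ k (λ i → Σᶠ n (λ j → a j * (lam i * z i j))) ≡⟨ Σᶠ-cong k (λ i → dot-⊙ a (lam i) (z i)) ⟩
  Σᶠ k (λ i → lam i * dot a (z i))                ∎
  where open ≡-Reasoning

-- Finitely generated cones and the double description method

-- A conic combination is recorded as a list of terms in which generators may repeat, so that adding
-- two combinations is concatenation. The equations are pointwise because points are functions.
data Generated {n} (R : List (Point n)) (x : Point n) : Set where
  nil  : x ≐ 𝟎 → Generated R x
  cons : ∀ {r y} t → r ∈ R → 0ℚ ≤ t → Generated R y → x ≐ t ⊙ r ⊕ y → Generated R x

module _ {n} {R : List (Point n)} where

  generated-resp-≐ : ∀ {x y} → x ≐ y → Generated R x → Generated R y
  generated-resp-≐ x≐y (nil x≐0) = nil λ j → trans (sym (x≐y j)) (x≐0 j)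
  generated-resp-≐ x≐y (cons t r∈R 0≤t g x≐) =
    cons t r∈R 0≤t g λ j → trans (sym (x≐y j)) (x≐ j)

  generated-⊕ : ∀ {x y} → Generated R x → Generated R y → Generated R (x ⊕ y)
  generated-⊕ {x} {y} (nil x≐0) h =
    generated-resp-≐ (λ j → sym (trans (cong (_+ y j) (x≐0 j)) (+-identityˡ (y j)))) h
  generated-⊕ {x} {y} (cons {r} {x′} t r∈R 0≤t g x≐) h =
    cons t r∈R 0≤t (generated-⊕ g h)
      λ j → trans (cong (_+ y j) (x≐ j)) (+-assoc (t * r j) (x′ j) (y j))

  generated-⊙ : ∀ {x t} → 0ℚ ≤ t → Generated R x → Generated R (t ⊙ x)
  generated-⊙ {x} {t} 0≤t (nil x≐0) = nil λ j → trans (cong (t *_) (x≐0 j)) (*-zeroʳ t)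
  generated-⊙ {x} {t} 0≤t (cons {r} {y} s r∈R 0≤s g x≐) =
    cons (t * s) r∈R (0≤* 0≤t 0≤s) (generated-⊙ 0≤t g)
      λ j → trans (cong (t *_) (x≐ j)) (lemma t s (r j) (y j))
    where
    lemma : ∀ t s r y → t * (s * r + y) ≡ t * s * r + t * y
    lemma = solve-∀ ℚ-ring

  generator : ∀ {r} → r ∈ R → Generated R r
  generator {r} r∈R = cons 1ℚ r∈R (nonNegative⁻¹ 1ℚ) (nil λ _ → refl) λ j → lemma (r j)
    where
    lemma : ∀ r → r ≡ 1ℚ * r + 0ℚ
    lemma = solve-∀ ℚ-ring

  generated-⊆ : ∀ {R′ x} → (∀ {r} → r ∈ R → r ∈ R′) → Generated R x → Generated R′ x
  generated-⊆ R⊆R′ (nil x≐0) = nil x≐0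
  generated-⊆ R⊆R′ (cons t r∈R 0≤t g x≐) = cons t (R⊆R′ r∈R) 0≤t (generated-⊆ R⊆R′ g) x≐

-- One step of the double description method.
module HalfSpace {n} (a : Point n) (R : List (Point n)) where

  R₊ R₋ R′ : List (Point n)

  -- For `r` in `R₊` and `s` in `R₋` both coefficients are nonnegative, so this is the ray in which
  -- the cone spanned by `r` and `s` meets the hyperplane where `a` vanishes.
  balance : Point n → Point n → Point n
  balance r s = dot a r ⊙ s ⊕ (- dot a s) ⊙ r

  R₊ = filter (λ r → 0ℚ ≤? dot a r) R
  R₋ = filter (λ r → dot a r ≤? 0ℚ) R
  R′ = R₋ List.++ cartesianProductWith balance R₊ R₋

  dot-balance : ∀ r s → dot a (balance r s) ≡ 0ℚ
  dot-balance r s = trans (dot-linear a (dot a r) (- dot a s) s r) (lemma (dot a r) (dot a s))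
    where
    lemma : ∀ x y → x * y + - y * x ≡ 0ℚ
    lemma = solve-∀ ℚ-ring

  R₋⊆R′ : ∀ {r} → r ∈ R₋ → r ∈ R′
  R₋⊆R′ = ∈-++⁺ˡ

  R′-preserves : (b : Point n) → (∀ {r} → r ∈ R → dot b r ≤ 0ℚ) → ∀ {r} → r ∈ R′ → dot b r ≤ 0ℚ
  R′-preserves b b≤0 {r} r∈R′ with ∈-++⁻ R₋ r∈R′
  ... | inj₁ r∈R₋ = b≤0 (proj₁ (∈-filter⁻ (λ r → dot a r ≤? 0ℚ) {xs = R} r∈R₋))
  ... | inj₂ r∈prod with ∈-cartesianProductWith⁻ balance R₊ R₋ r∈prod
  ... | p , s , p∈R₊ , s∈R₋ , refl with ∈-filter⁻ (λ r → 0ℚ ≤? dot a r) {xs = R} p∈R₊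
                                       | ∈-filter⁻ (λ r → dot a r ≤? 0ℚ) {xs = R} s∈R₋
  ... | p∈R , 0≤ap | s∈R , as≤0 =
    0≤-⇒≤ _ (0≤+ (0≤* 0≤ap (≤0⇒0≤neg (b≤0 s∈R))) (0≤* (≤0⇒0≤neg as≤0) (≤0⇒0≤neg (b≤0 p∈R))))
      (trans (cong (λ v → 0ℚ - v) (dot-linear b (dot a p) (- dot a s) s p))
             (lemma (dot a p) (dot a s) (dot b p) (dot b s)))
    where
    lemma : ∀ x y u v → 0ℚ - (x * v + - y * u) ≡ x * - v + - y * - u
    lemma = solve-∀ ℚ-ring

  R′-satisfies : ∀ {r} → r ∈ R′ → dot a r ≤ 0ℚ
  R′-satisfies {r} r∈R′ with ∈-++⁻ R₋ r∈R′
  ... | inj₁ r∈R₋ = proj₂ (∈-filter⁻ (λ r → dot a r ≤? 0ℚ) {xs = R} r∈R₋)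
  ... | inj₂ r∈prod with ∈-cartesianProductWith⁻ balance R₊ R₋ r∈prod
  ... | p , s , _ , _ , refl = ≤-reflexive (dot-balance p s)

  dot-cons : ∀ {x} t r y → x ≐ t ⊙ r ⊕ y → dot a x ≡ t * dot a r + dot a y
  dot-cons t r y x≐ =
    trans (dot-cong a x≐) (trans (dot-⊕ a (t ⊙ r) y) (cong (_+ dot a y) (dot-⊙ a t r)))

  -- `balance` is linear in each argument, so the expansion of `v` over `R₋` turns term by term into
  -- one over the new generators; `balance-generated` then expands the other argument.
  balance-generatorˡ : ∀ {r v} → r ∈ R₊ → Generated R₋ v → Generated R′ (balance r v)
  balance-generatorˡ {r} {v} r∈R₊ (nil v≐0) = nil λ j →
    trans (cong₂ (λ p q → dot a r * p + - q * r j) (v≐0 j) (trans (dot-cong a v≐0) (dot-𝟎 a)))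
          (lemma (dot a r) (r j))
    where
    lemma : ∀ x y → x * 0ℚ + - 0ℚ * y ≡ 0ℚ
    lemma = solve-∀ ℚ-ring
  balance-generatorˡ {r} {v} r∈R₊ (cons {s} {v′} t s∈R₋ 0≤t g v≐) =
    cons t (∈-++⁺ʳ R₋ (∈-cartesianProductWith⁺ balance r∈R₊ s∈R₋)) 0≤t (balance-generatorˡ r∈R₊ g) λ j →
      trans (cong₂ (λ p q → dot a r * p + - q * r j) (v≐ j) (dot-cons t s v′ v≐))
            (lemma (dot a r) (dot a s) (dot a v′) t (r j) (s j) (v′ j))
    where
    lemma : ∀ ρ σ ν t r s v →
      ρ * (t * s + v) + - (t * σ + ν) * r ≡ t * (ρ * s + - σ * r) + (ρ * v + - ν * r)
    lemma = solve-∀ ℚ-ring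

  balance-generated : ∀ {z v} → Generated R₊ z → Generated R₋ v → Generated R′ (balance z v)
  balance-generated {z} {v} (nil z≐0) h = nil λ j →
    trans (cong₂ (λ p q → p * v j + - dot a v * q) (trans (dot-cong a z≐0) (dot-𝟎 a)) (z≐0 j))
          (lemma (dot a v) (v j))
    where
    lemma : ∀ x y → 0ℚ * y + - x * 0ℚ ≡ 0ℚ
    lemma = solve-∀ ℚ-ring
  balance-generated {z} {v} (cons {r} {z′} t r∈R₊ 0≤t g z≐) h =
    generated-resp-≐
      (λ j → sym (trans (cong₂ (λ p q → p * v j + - dot a v * q) (dot-cons t r z′ z≐) (z≐ j))
                        (lemma (dot a r) (dot a z′) (dot a v) t (r j) (z′ j) (v j))))
      (generated-⊕ (generated-⊙ 0≤t (balance-generatorˡ r∈R₊ h)) (balance-generated g h))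
    where
    lemma : ∀ ρ ζ ν t r z v →
      (t * ρ + ζ) * v + - ν * (t * r + z) ≡ t * (ρ * v + - ν * r) + (ζ * v + - ν * z)
    lemma = solve-∀ ℚ-ring

  R₊-nonNeg : ∀ {z} → Generated R₊ z → 0ℚ ≤ dot a z
  R₊-nonNeg (nil z≐0) = ≤-reflexive (sym (trans (dot-cong a z≐0) (dot-𝟎 a)))
  R₊-nonNeg (cons {r} {y} t r∈R₊ 0≤t g z≐) =
    subst (0ℚ ≤_) (sym (dot-cons t r y z≐))
      (0≤+ (0≤* 0≤t (proj₂ (∈-filter⁻ (λ r → 0ℚ ≤? dot a r) {xs = R} r∈R₊))) (R₊-nonNeg g))

  tail-nonPos : ∀ {z t r y} → r ∈ R₊ → 0ℚ ≤ t → z ≐ t ⊙ r ⊕ y → dot a z ≤ 0ℚ → dot a y ≤ 0ℚ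
  tail-nonPos {z} {t} {r} {y} r∈R₊ 0≤t z≐ az≤0 =
    0≤-⇒≤ _ (0≤+ (≤⇒0≤- (subst (_≤ 0ℚ) (dot-cons t r y z≐) az≤0)) (0≤* 0≤t 0≤ar))
      (lemma t (dot a r) (dot a y))
    where
    0≤ar = proj₂ (∈-filter⁻ (λ r → 0ℚ ≤? dot a r) {xs = R} r∈R₊)
    lemma : ∀ t ρ η → 0ℚ - η ≡ (0ℚ - (t * ρ + η)) + t * ρ
    lemma = solve-∀ ℚ-ring

  -- `a` is nonnegative on every term of `z` but not positive on `z`, so each term vanishes under
  -- `a`: either `r` lies on the hyperplane and hence also in `R₋`, or its coefficient is zero.
  tight-cons : ∀ {z t r y} → r ∈ R₊ → 0ℚ ≤ t → z ≐ t ⊙ r ⊕ y → Generated R₊ y → dot a z ≤ 0ℚ →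
    Generated R′ y → Generated R′ z
  tight-cons {z} {t} {r} {y} r∈R₊ 0≤t z≐ g az≤0 h with dot a r ≤? 0ℚ | t ≤? 0ℚ
  ... | yes ar≤0 | _ = cons t (R₋⊆R′ (∈-filter⁺ (λ r → dot a r ≤? 0ℚ) r∈R ar≤0)) 0≤t h z≐
    where
    r∈R = proj₁ (∈-filter⁻ (λ r → 0ℚ ≤? dot a r) {xs = R} r∈R₊)
  ... | no ar≰0 | yes t≤0 = generated-resp-≐ y≐z h
    where
    lemma : ∀ r y → 0ℚ * r + y ≡ y
    lemma = solve-∀ ℚ-ring
    y≐z : y ≐ z
    y≐z j = sym (trans (z≐ j)
      (trans (cong (λ s → s * r j + y j) (≤-antisym t≤0 0≤t)) (lemma (r j) (y j))))
  ... | no ar≰0 | no t≰0 = contradiction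
    (≤-<-trans az≤0 (subst (0ℚ <_) (sym (dot-cons t r y z≐))
      (subst (_< t * dot a r + dot a y) (+-identityˡ 0ℚ)
        (+-mono-<-≤ (0<* (≰⇒> t≰0) (≰⇒> ar≰0)) (R₊-nonNeg g)))))
    (<-irrefl refl)

  tight-generated : ∀ {z} → Generated R₊ z → dot a z ≤ 0ℚ → Generated R′ z
  tight-generated (nil z≐0) az≤0 = nil z≐0
  tight-generated (cons t r∈R₊ 0≤t g z≐) az≤0 =
    tight-cons r∈R₊ 0≤t z≐ g az≤0 (tight-generated g (tail-nonPos r∈R₊ 0≤t z≐ az≤0))

  split : ∀ {x} → Generated R x → ∃₂ λ z v → Generated R₊ z × Generated R₋ v × x ≐ z ⊕ v
  split (nil x≐0) = 𝟎 , 𝟎 , nil (λ _ → refl) , nil (λ _ → refl) , x≐0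
  split {x} (cons {r} {y} t r∈R 0≤t g x≐) with split g | dot a r ≤? 0ℚ
  ... | z , v , gz , gv , y≐ | yes ar≤0 =
    z , t ⊙ r ⊕ v , gz ,
    cons t (∈-filter⁺ (λ r → dot a r ≤? 0ℚ) r∈R ar≤0) 0≤t gv (λ _ → refl) ,
    λ j → trans (x≐ j) (trans (cong (t * r j +_) (y≐ j)) (lemma (t * r j) (z j) (v j)))
    where
    lemma : ∀ p z v → p + (z + v) ≡ z + (p + v)
    lemma = solve-∀ ℚ-ring
  ... | z , v , gz , gv , y≐ | no ar≰0 =
    t ⊙ r ⊕ z , v ,
    cons t (∈-filter⁺ (λ r → 0ℚ ≤? dot a r) r∈R (<⇒≤ (≰⇒> ar≰0))) 0≤t gz (λ _ → refl) , gv ,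
    λ j → trans (x≐ j) (trans (cong (t * r j +_) (y≐ j)) (sym (+-assoc (t * r j) (z j) (v j))))

  -- Let x = z + v, with σ = `dot a z` and τ = - `dot a v`, so σ ≤ τ. If σ is positive, then x = (1
  -- - σ/τ) v + (1/τ) `balance z v`: a share of `v` just large enough to cancel `z` is used up, and
  -- the remaining share of `v` is nonnegative.
  R′-complete : ∀ {x} → Generated R x → dot a x ≤ 0ℚ → Generated R′ x
  R′-complete {x} g ax≤0 with split g
  ... | z , v , gz , gv , x≐ with dot a z ≤? 0ℚ
  ... | yes az≤0 = generated-resp-≐ (λ j → sym (x≐ j))
    (generated-⊕ (tight-generated gz az≤0) (generated-⊆ R₋⊆R′ gv))
  ... | no az≰0 = generated-resp-≐ recombine
    (generated-⊕ (generated-⊙ (subst (0ℚ ≤_) weight (0≤* (<⇒≤ 0<u) 0≤τ-σ)) (generated-⊆ R₋⊆R′ gv))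
                 (generated-⊙ (<⇒≤ 0<u) (balance-generated gz gv)))
    where
    σ τ : ℚ
    σ = dot a z
    τ = - dot a v
    0≤τ-σ : 0ℚ ≤ τ - σ
    0≤τ-σ = subst (0ℚ ≤_) (lemma σ (dot a v)) (≤0⇒0≤neg (subst (_≤ 0ℚ) (trans (dot-cong a x≐) (dot-⊕ a z v)) ax≤0))
      where
      lemma : ∀ σ ν → - (σ + ν) ≡ - ν - σ
      lemma = solve-∀ ℚ-ring
    0<τ : 0ℚ < τ
    0<τ = <-≤-trans (≰⇒> az≰0) (0≤-⇒≤ (τ - σ) 0≤τ-σ refl)
    u = proj₁ (reciprocal 0<τ)
    0<u = proj₁ (proj₂ (reciprocal 0<τ))
    uτ≡1 : u * τ ≡ 1ℚ
    uτ≡1 = proj₂ (proj₂ (reciprocal 0<τ))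
    weight : u * (τ - σ) ≡ 1ℚ - u * σ
    weight = trans (lemma u τ σ) (cong (_- u * σ) uτ≡1)
      where
      lemma : ∀ u τ σ → u * (τ - σ) ≡ u * τ - u * σ
      lemma = solve-∀ ℚ-ring
    recombine : (1ℚ - u * σ) ⊙ v ⊕ u ⊙ balance z v ≐ x
    recombine j = trans (lemma u τ σ (z j) (v j))
      (trans (cong (λ w → v j + w * z j) uτ≡1) (trans (lemma′ (z j) (v j)) (sym (x≐ j))))
      where
      lemma : ∀ u τ σ z v → (1ℚ - u * σ) * v + u * (σ * v + τ * z) ≡ v + (u * τ) * z
      lemma = solve-∀ ℚ-ring
      lemma′ : ∀ z v → v + 1ℚ * z ≡ z + v
      lemma′ = solve-∀ ℚ-ring

axes : ∀ n → List (Point n)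
axes zero    = []
axes (suc n) = (1ℚ Vector.∷ 𝟎) ∷ (- 1ℚ Vector.∷ 𝟎) ∷ List.map (0ℚ Vector.∷_) (axes n)

axes-generate : ∀ n (x : Point n) → Generated (axes n) x
axes-generate zero    x = nil λ ()
axes-generate (suc n) x = generated-resp-≐ head⊕tail (generated-⊕ head (lift (axes-generate n (x ∘ suc))))
  where
  lift : ∀ {y} → Generated (axes n) y → Generated (axes (suc n)) (0ℚ Vector.∷ y)
  lift (nil y≐0) = nil λ { zero → refl ; (suc j) → y≐0 j }
  lift (cons {r} {y} t r∈ 0≤t g y≐) = cons t (there (there (∈-map⁺ (0ℚ Vector.∷_) r∈))) 0≤t (lift g)
    λ { zero → lemma t ; (suc j) → y≐ j }
    where
    lemma : ∀ t → 0ℚ ≡ t * 0ℚ + 0ℚ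
    lemma = solve-∀ ℚ-ring
  head : Generated (axes (suc n)) (x zero Vector.∷ 𝟎)
  head with 0ℚ ≤? x zero
  ... | yes 0≤x₀ = generated-resp-≐ (λ { zero → *-identityʳ (x zero) ; (suc j) → *-zeroʳ (x zero) })
    (generated-⊙ 0≤x₀ (generator (here refl)))
  ... | no 0≰x₀ = generated-resp-≐ (λ { zero → lemma (x zero) ; (suc j) → *-zeroʳ (- x zero) })
    (generated-⊙ (≤0⇒0≤neg (<⇒≤ (≰⇒> 0≰x₀))) (generator (there (here refl))))
    where
    lemma : ∀ x → - x * - 1ℚ ≡ x
    lemma = solve-∀ ℚ-ring
  head⊕tail : (x zero Vector.∷ 𝟎) ⊕ (0ℚ Vector.∷ x ∘ suc) ≐ x
  head⊕tail zero    = +-identityʳ (x zero)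
  head⊕tail (suc j) = +-identityˡ (x (suc j))

-- The Minkowski-Weyl theorem in the direction from inequalities to generators: the half-spaces are
-- imposed one by one on the whole space, which the signed coordinate vectors generate.
weyl : ∀ {n} k (A : Fin k → Point n) → Σ (List (Point n)) λ R →
  (∀ {r} → r ∈ R → ∀ i → dot (A i) r ≤ 0ℚ) ×
  (∀ x → (∀ i → dot (A i) x ≤ 0ℚ) → Generated R x)
weyl {n} zero    A = axes n , (λ _ ()) , λ x _ → axes-generate n x
weyl     (suc k) A with weyl k (A ∘ suc)
... | R , sound , complete = R′ ,
  (λ { r∈R′ zero    → R′-satisfies r∈R′
     ; r∈R′ (suc i) → R′-preserves (A (suc i)) (λ r∈R → sound r∈R i) r∈R′ }) ,
  λ x Ax≤0 → R′-complete (complete x (Ax≤0 ∘ suc)) (Ax≤0 zero)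
  where open HalfSpace (A zero) R

-- Boxes and bounds

WithinBox : ∀ {n} → (l u : Fin n → ℤ) → Point n → Set
WithinBox l u x = ∀ j → fromℤ (l j) ≤ x j × x j ≤ fromℤ (u j)

Within : ∀ {n} → ℚ → Point n → Set
Within M x = ∀ j → - M ≤ x j × x j ≤ M

within-mono : ∀ {n M N} {x : Point n} → M ≤ N → Within M x → Within N x
within-mono M≤N w j = ≤-trans (neg-antimono-≤ M≤N) (proj₁ (w j)) , ≤-trans (proj₂ (w j)) M≤N

within-⊕ : ∀ {n M N} {x y : Point n} → Within M x → Within N y → Within (M + N) (x ⊕ y)
within-⊕ {M = M} {N} {x} {y} w w′ j =
  subst (_≤ x j + y j) (sym (neg-distrib-+ M N)) (+-mono-≤ (proj₁ (w j)) (proj₁ (w′ j))) ,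
  +-mono-≤ (proj₂ (w j)) (proj₂ (w′ j))

within-⊙ : ∀ {n M t} {x : Point n} → 0ℚ ≤ t → Within M x → Within (t * M) (t ⊙ x)
within-⊙ {M = M} {t} {x} 0≤t w j =
  subst (_≤ t * x j) (sym (neg-distribʳ-* t M)) (*-monoˡ-≤-nonNeg t (proj₁ (w j))) ,
  *-monoˡ-≤-nonNeg t (proj₂ (w j))
  where instance
  t-nonNeg : NonNegative t
  t-nonNeg = nonNegative 0≤t

within-𝟎 : ∀ {n} → Within {n} 0ℚ 𝟎
within-𝟎 j = ≤-refl , ≤-refl

-∣p∣≤p : ∀ p → - ∣ p ∣ ≤ p
-∣p∣≤p p with ∣p∣≡p∨∣p∣≡-p p
... | inj₁ eq = ≤-trans (neg-antimono-≤ (0≤∣p∣ p)) (subst (0ℚ ≤_) eq (0≤∣p∣ p))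
... | inj₂ eq = ≤-reflexive (trans (cong -_ eq) (neg-involutive p))

p≤∣p∣ : ∀ p → p ≤ ∣ p ∣
p≤∣p∣ p with ∣p∣≡p∨∣p∣≡-p p
... | inj₁ eq = ≤-reflexive (sym eq)
... | inj₂ eq = ≤-trans (subst (_≤ 0ℚ) (neg-involutive p) (neg-antimono-≤ (subst (0ℚ ≤_) eq (0≤∣p∣ p)))) (0≤∣p∣ p)

within-bound : ∀ {n} (x : Point n) → ∃ λ M → 0ℚ ≤ M × Within M x
within-bound {zero}  x = 0ℚ , ≤-refl , λ ()
within-bound {suc n} x with within-bound (x ∘ suc)
... | M , 0≤M , w = ∣ x zero ∣ + M , 0≤+ (0≤∣p∣ (x zero)) 0≤M , λ
  { zero    → ≤-trans (neg-antimono-≤ ∣x₀∣≤) (-∣p∣≤p (x zero)) , ≤-trans (p≤∣p∣ (x zero)) ∣x₀∣≤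
  ; (suc j) → within-mono M≤ w j }
  where
  ∣x₀∣≤ : ∣ x zero ∣ ≤ ∣ x zero ∣ + M
  ∣x₀∣≤ = subst (_≤ ∣ x zero ∣ + M) (+-identityʳ _) (+-monoʳ-≤ ∣ x zero ∣ 0≤M)
  M≤ : M ≤ ∣ x zero ∣ + M
  M≤ = subst (_≤ ∣ x zero ∣ + M) (+-identityˡ _) (+-monoˡ-≤ M (0≤∣p∣ (x zero)))

-- A generator of positive first coordinate stands for the point obtained by dividing by that
-- coordinate. `M` bounds these finitely many points, and is stated without division so that the
-- bounds add up along conic combinations.
homogeneous-bound : ∀ {n} (R : List (Point (suc n))) →
  ∃ λ M → 0ℚ ≤ M × (∀ {r} → r ∈ R → 0ℚ < r zero → Within (r zero * M) (r ∘ suc))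
homogeneous-bound []      = 0ℚ , ≤-refl , λ ()
homogeneous-bound (r ∷ R) with homogeneous-bound R | 0ℚ <? r zero
... | M , 0≤M , w | no  0≮t = M , 0≤M , λ { (here refl) 0<t → contradiction 0<t 0≮t ; (there r∈R) → w r∈R }
... | M , 0≤M , w | yes 0<t with reciprocal 0<t
... | s , 0<s , st≡1 with within-bound (s ⊙ (r ∘ suc))
... | N , 0≤N , w′ = N + M , 0≤+ 0≤N 0≤M , bounded
  where
  N≤ : N ≤ N + M
  N≤ = subst (_≤ N + M) (+-identityʳ N) (+-monoʳ-≤ N 0≤M)
  M≤ : M ≤ N + M
  M≤ = subst (_≤ N + M) (+-identityˡ M) (+-monoˡ-≤ M 0≤N)
  rescale : r zero ⊙ (s ⊙ (r ∘ suc)) ≐ r ∘ suc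
  rescale j = trans (lemma (r zero) s (r (suc j))) (trans (cong (_* r (suc j)) st≡1) (*-identityˡ _))
    where
    lemma : ∀ t s x → t * (s * x) ≡ s * t * x
    lemma = solve-∀ ℚ-ring
  rescaled : ∀ {B} → Within B (r zero ⊙ (s ⊙ (r ∘ suc))) → Within B (r ∘ suc)
  rescaled {B} w j = subst (λ v → - B ≤ v × v ≤ B) (rescale j) (w j)
  bounded : ∀ {y} → y ∈ r ∷ R → 0ℚ < y zero → Within (y zero * (N + M)) (y ∘ suc)
  bounded (here refl) _ = rescaled (within-⊙ (<⇒≤ 0<t) (within-mono N≤ w′))
  bounded {y} (there y∈R) 0<y₀ =
    within-mono (*-monoˡ-≤-nonNeg (y zero) {{nonNegative (<⇒≤ 0<y₀)}} M≤) (w y∈R 0<y₀)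

-- Homogenization and decomposition of a polyhedron

recession : ∀ {n} → Polyhedron n → Polyhedron n
recession P = record { m = m ; A = A ; b = λ _ → 0ℚ }
  where open Polyhedron P

module _ {n} (P : Polyhedron n) where
  open Polyhedron P

  -- With the first coordinate y₀ read as a height, the rows say y₀ ≥ 0 and A y ≤ y₀ b. The slice at
  -- height one is `P`, and the slice at height zero is its recession cone.
  homogenized : Fin (suc m) → Point (suc n)
  homogenized zero    = - 1ℚ Vector.∷ 𝟎
  homogenized (suc i) = - b i Vector.∷ A i

  -- The required decomposition scaled to the height of `y`, which makes it additive over the terms
  -- of a conic combination; height one gives back the statement about `P`.
  Decomposed : ℚ → Point (suc n) → Set
  Decomposed M y = ∃₂ λ q c → (y ∘ suc ≐ q ⊕ c) × (∀ i → dot (A i) q ≤ y zero * b i) ×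
    Within (y zero * M) q × c ∈P recession P

  -- Generators of positive height are collected in `q`, those of height zero in `c`. The row
  -- `homogenized zero` excludes negative heights.
  decompose-generated : ∀ {M} (R : List (Point (suc n))) →
    (∀ {r} → r ∈ R → ∀ i → dot (homogenized i) r ≤ 0ℚ) →
    (∀ {r} → r ∈ R → 0ℚ < r zero → Within (r zero * M) (r ∘ suc)) →
    ∀ {y} → Generated R y → Decomposed M y
  decompose-generated {M} R sound bound {y} (nil y≐0) =
    𝟎 , 𝟎 , (λ j → y≐0 (suc j)) ,
    (λ i → ≤-reflexive (trans (dot-𝟎 (A i)) (sym (vanish (b i))))) ,
    subst (λ v → Within v 𝟎) (sym (vanish M)) within-𝟎 ,
    λ i → ≤-reflexive (dot-𝟎 (A i))
    where
    vanish : ∀ v → y zero * v ≡ 0ℚ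
    vanish v = trans (cong (_* v) (y≐0 zero)) (*-zeroˡ v)
  decompose-generated {M} R sound bound {y} (cons {r} {y′} t r∈R 0≤t g y≐)
    with decompose-generated R sound bound g | 0ℚ <? r zero
  ... | q , c , y′≐ , Aq≤ , wq , Ac≤0 | yes 0<r₀ =
    t ⊙ (r ∘ suc) ⊕ q , c ,
    (λ j → trans (y≐ (suc j)) (trans (cong (t * r (suc j) +_) (y′≐ j)) (sym (+-assoc (t * r (suc j)) (q j) (c j))))) ,
    (λ i → 0≤-⇒≤ _ (0≤+ (0≤* 0≤t (≤0⇒0≤neg (sound r∈R (suc i)))) (≤⇒0≤- (Aq≤ i)))
      (trans (cong₂ (λ p d → p * b i - d) (y≐ zero)
               (trans (dot-⊕ (A i) (t ⊙ (r ∘ suc)) q) (cong (_+ dot (A i) q) (dot-⊙ (A i) t (r ∘ suc)))))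
             (lemma t (r zero) (y′ zero) (b i) (dot (A i) (r ∘ suc)) (dot (A i) q)))) ,
    subst (λ v → Within v (t ⊙ (r ∘ suc) ⊕ q)) (trans (lemma′ t (r zero) (y′ zero) M) (cong (_* M) (sym (y≐ zero))))
      (within-⊕ (within-⊙ 0≤t (bound r∈R 0<r₀)) wq) ,
    Ac≤0
    where
    lemma : ∀ t r y b α β → (t * r + y) * b - (t * α + β) ≡ t * - (- b * r + α) + (y * b - β)
    lemma = solve-∀ ℚ-ring
    lemma′ : ∀ t r y M → t * (r * M) + y * M ≡ (t * r + y) * M
    lemma′ = solve-∀ ℚ-ring
  ... | q , c , y′≐ , Aq≤ , wq , Ac≤0 | no 0≮r₀ =
    q , t ⊙ (r ∘ suc) ⊕ c ,
    (λ j → trans (y≐ (suc j)) (trans (cong (t * r (suc j) +_) (y′≐ j)) (lemma (t * r (suc j)) (q j) (c j)))) ,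
    (λ i → subst (λ v → dot (A i) q ≤ v * b i) (sym y₀≡y′₀) (Aq≤ i)) ,
    subst (λ v → Within (v * M) q) (sym y₀≡y′₀) wq ,
    λ i → 0≤-⇒≤ _ (0≤+ (0≤* 0≤t (≤0⇒0≤neg (sound r∈R (suc i)))) (≤⇒0≤- (Ac≤0 i)))
      (trans (cong (λ d → 0ℚ - d)
               (trans (dot-⊕ (A i) (t ⊙ (r ∘ suc)) c) (cong (_+ dot (A i) c) (dot-⊙ (A i) t (r ∘ suc)))))
        (trans (lemma″ t (b i) (dot (A i) (r ∘ suc)) (dot (A i) c))
          (cong (λ v → t * - (- b i * v + dot (A i) (r ∘ suc)) + (0ℚ - dot (A i) c)) (sym r₀≡0))))
    where
    r₀≡0 : r zero ≡ 0ℚ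
    r₀≡0 = ≤-antisym (≮⇒≥ 0≮r₀) (0≤-⇒≤ _ (≤0⇒0≤neg (sound r∈R zero))
      (trans (lemma₀ (r zero)) (cong (λ v → - (- 1ℚ * r zero + v)) (sym (Σᶠ-zero n λ j → *-zeroˡ (r (suc j)))))))
      where
      lemma₀ : ∀ x → x - 0ℚ ≡ - (- 1ℚ * x + 0ℚ)
      lemma₀ = solve-∀ ℚ-ring
    y₀≡y′₀ : y zero ≡ y′ zero
    y₀≡y′₀ = trans (y≐ zero) (trans (cong (λ v → t * v + y′ zero) r₀≡0) (lemma₁ t (y′ zero)))
      where
      lemma₁ : ∀ t y → t * 0ℚ + y ≡ y
      lemma₁ = solve-∀ ℚ-ring
    lemma : ∀ p z v → p + (z + v) ≡ z + (p + v)
    lemma = solve-∀ ℚ-ring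
    lemma″ : ∀ t b α β → 0ℚ - (t * α + β) ≡ t * - (- b * 0ℚ + α) + (0ℚ - β)
    lemma″ = solve-∀ ℚ-ring

  -- Abstract since the bound is an enormous explicit term.
  abstract
    decomposition : ∃ λ M → ∀ x → x ∈P P →
      ∃₂ λ q c → x ≐ q ⊕ c × q ∈P P × Within M q × c ∈P recession P
    decomposition with weyl (suc m) homogenized
    ... | R , sound , complete with homogeneous-bound R
    ... | M , 0≤M , bound = M , decompose
      where
      decompose : ∀ x → x ∈P P → ∃₂ λ q c → x ≐ q ⊕ c × q ∈P P × Within M q × c ∈P recession P
      decompose x x∈P with decompose-generated R sound bound (complete (1ℚ Vector.∷ x) λ
        { zero    → ≤-trans (≤-reflexive (cong (- 1ℚ * 1ℚ +_) (Σᶠ-zero n λ j → *-zeroˡ (x j)))) (nonPositive⁻¹ _)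
        ; (suc i) → 0≤-⇒≤ _ (≤⇒0≤- (x∈P i)) (lemma (b i) (dot (A i) x)) })
        where
        lemma : ∀ b α → 0ℚ - (- b * 1ℚ + α) ≡ b - α
        lemma = solve-∀ ℚ-ring
      ... | q , c , x≐ , Aq≤ , wq , Ac≤0 =
        q , c , x≐ , (λ i → subst (dot (A i) q ≤_) (*-identityˡ (b i)) (Aq≤ i)) ,
        subst (λ v → Within v q) (*-identityˡ M) wq , Ac≤0

-- Common denominators and discreteness of linear functionals

1≤fromℤ[1+n] : ∀ n → 1ℚ ≤ fromℤ (ℤ.+ suc n)
1≤fromℤ[1+n] n = fromℤ-mono-≤ {1ℤ} {ℤ.+ suc n} (+≤+ (s≤s z≤n))

↧-clears : ∀ q → fromℤ (↧ q) * q ≡ fromℤ (↥ q)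
↧-clears q@(mkℚ n d-1 _) = toℚᵘ-injective (begin
  toℚᵘ (fromℤ (↧ q) * q)                  ≈⟨ toℚᵘ-homo-* (fromℤ (↧ q)) q ⟩
  toℚᵘ (fromℤ (↧ q)) ℚᵘ.* toℚᵘ q          ≈⟨ ℚᵘ.*-congʳ {toℚᵘ q} (toℚᵘ-fromℤ (↧ q)) ⟩
  mkℚᵘ (↧ q) 0 ℚᵘ.* mkℚᵘ n d-1            ≈⟨ ℚᵘ.*≡* cross ⟩
  mkℚᵘ n 0                                ≈⟨ toℚᵘ-fromℤ n ⟨
  toℚᵘ (fromℤ n)                          ∎)
  where
  open ℚᵘ.≃-Reasoning
  cross : (ℤ.+ suc d-1 ℤ.* n) ℤ.* 1ℤ ≡ n ℤ.* (ℤ.+ suc (d-1 ℕ.+ 0))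
  cross = trans (ℤ.*-identityʳ _) (trans (ℤ.*-comm (ℤ.+ suc d-1) n)
    (cong (λ e → n ℤ.* ℤ.+ suc e) (sym (ℕ.+-identityʳ d-1))))

common-denominator : ∀ {n} (g : Point n) →
  ∃ λ D → 0ℚ < D × Integral D × (∀ j → Integral (D * g j))
common-denominator {zero}  g = 1ℚ , positive⁻¹ 1ℚ , (1ℤ , refl) , λ ()
common-denominator {suc n} g with common-denominator (g ∘ suc)
... | D , 0<D , D∈ℤ , Dg∈ℤ = d * D , 0<* 0<d 0<D , integral-* d∈ℤ D∈ℤ , λ
  { zero    → subst Integral (lemma d (g zero) D) (integral-* (↥ (g zero) , ↧-clears (g zero)) D∈ℤ)
  ; (suc j) → subst Integral (sym (*-assoc d D (g (suc j)))) (integral-* d∈ℤ (Dg∈ℤ j)) }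
  where
  d = fromℤ (↧ (g zero))
  d∈ℤ : Integral d
  d∈ℤ = ↧ (g zero) , refl
  0<d : 0ℚ < d
  0<d = <-≤-trans (positive⁻¹ 1ℚ) (1≤fromℤ[1+n] (ℚ.denominator-1 (g zero)))
  lemma : ∀ d g D → d * g * D ≡ d * D * g
  lemma = solve-∀ ℚ-ring

integral-Σᶠ : ∀ k {f : Fin k → ℚ} → (∀ i → Integral (f i)) → Integral (Σᶠ k f)
integral-Σᶠ zero    f∈ℤ = 0ℤ , refl
integral-Σᶠ (suc k) f∈ℤ = integral-+ (f∈ℤ zero) (integral-Σᶠ k (f∈ℤ ∘ suc))

integral-gap : ∀ {p q} → Integral p → Integral q → p < q → 1ℚ + p ≤ q
integral-gap (y , refl) (z , refl) y<z =
  subst (_≤ fromℤ z) (fromℤ-+ 1ℤ y) (fromℤ-mono-≤ (ℤ.i<j⇒suc[i]≤j (ℤ.≰⇒> z≰y)))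
  where
  z≰y : ¬ z ℤ.≤ y
  z≰y z≤y = contradiction (<-≤-trans y<z (fromℤ-mono-≤ z≤y)) (<-irrefl refl)

∣∣-mono-< : ∀ {y z} → 0ℤ ℤ.≤ y → ℤ.suc y ℤ.≤ z → ℤ.∣ y ∣ ℕ.< ℤ.∣ z ∣
∣∣-mono-< (+≤+ _) (+≤+ y<z) = y<z

-- A functional bounded above by β takes discrete values at integral points, so its slack
-- there can be measured by a natural number.
slack-measure : ∀ {n} (g : Point n) β → ∃ λ (ν : Point n → ℕ) → ∀ {p z} →
  IsIntegral p → IsIntegral z → dot g p ≤ β → dot g z ≤ β →
  (dot g p < dot g z → ν z ℕ.< ν p) × (dot g p ≡ dot g z → ν z ≡ ν p)
slack-measure {n} g β with common-denominator g
... | D , 0<D , _ , Dg∈ℤ = ν , λ p∈ℤ z∈ℤ gp≤β gz≤β →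
  decrease p∈ℤ z∈ℤ gz≤β , λ eq → cong (λ v → ℤ.∣ floor (D * (β - v)) ∣) (sym eq)
  where
  ν : Point n → ℕ
  -- `D` clears the denominators of `g` only, so `D * β` may be fractional and a floor is taken.
  -- Since `D * dot g p` is an integer, a strict increase of it is at least one and still lowers the
  -- floor.
  ν p = ℤ.∣ floor (D * (β - dot g p)) ∣
  Ddot∈ℤ : ∀ {p} → IsIntegral p → Integral (D * dot g p)
  Ddot∈ℤ {p} p∈ℤ = subst Integral
    (trans (Σᶠ-cong n λ j → *-assoc D (g j) (p j)) (Σᶠ-scale n D (λ j → g j * p j)))
    (integral-Σᶠ n λ j → integral-* (Dg∈ℤ j) (p∈ℤ j))
  decrease : ∀ {p z} → IsIntegral p → IsIntegral z → dot g z ≤ β → dot g p < dot g z → ν z ℕ.< ν p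
  decrease {p} {z} p∈ℤ z∈ℤ gz≤β gp<gz = ∣∣-mono-<
    (floor-greatest {0ℤ} (0≤* (<⇒≤ 0<D) (≤⇒0≤- gz≤β)))
    (floor-greatest {ℤ.suc (floor Dsz)} {D * (β - dot g p)} (≤-trans (≤-reflexive (fromℤ-+ 1ℤ (floor Dsz)))
      (≤-trans (+-monoʳ-≤ 1ℚ (floor-≤ Dsz))
        (0≤-⇒≤ _ (≤⇒0≤- gap) (lemma D β (dot g p) (dot g z))))))
    where
    Dsz = D * (β - dot g z)
    gap : 1ℚ + D * dot g p ≤ D * dot g z
    gap = integral-gap (Ddot∈ℤ p∈ℤ) (Ddot∈ℤ z∈ℤ) (*-monoʳ-<-pos D {{positive 0<D}} gp<gz)
    lemma : ∀ D β p z → D * (β - p) - (1ℚ + D * (β - z)) ≡ D * z - (1ℚ + D * p)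
    lemma = solve-∀ ℚ-ring

-- Weighted averages and lexicographic signs

LexPositive : ∀ {m} → (Fin m → ℚ) → Set
LexPositive {zero}  c = ⊥
LexPositive {suc m} c = 0ℚ < c zero ⊎ (c zero ≡ 0ℚ × LexPositive (c ∘ suc))

Σᶠ-nonPositive-zero : ∀ k {f : Fin k → ℚ} → (∀ i → f i ≤ 0ℚ) → Σᶠ k f ≡ 0ℚ → ∀ i → f i ≡ 0ℚ
Σᶠ-nonPositive-zero (suc k) {f} f≤0 Σf≡0 = λ
  { zero    → f₀≡0
  ; (suc i) → Σᶠ-nonPositive-zero k (f≤0 ∘ suc) tail≡0 i }
  where
  tail≤0 : Σᶠ k (f ∘ suc) ≤ 0ℚ
  tail≤0 = subst (Σᶠ k (f ∘ suc) ≤_) (Σᶠ-zero k λ _ → refl) (Σᶠ-mono-≤ k (f≤0 ∘ suc))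
  lemma : ∀ x y → x - 0ℚ ≡ (x + y) + - y
  lemma = solve-∀ ℚ-ring
  f₀≡0 : f zero ≡ 0ℚ
  f₀≡0 = ≤-antisym (f≤0 zero) (0≤-⇒≤ _
    (0≤+ (≤-reflexive (sym Σf≡0)) (≤0⇒0≤neg tail≤0)) (lemma (f zero) (Σᶠ k (f ∘ suc))))
  tail≡0 : Σᶠ k (f ∘ suc) ≡ 0ℚ
  tail≡0 = trans (sym (+-identityˡ _)) (trans (cong (_+ Σᶠ k (f ∘ suc)) (sym f₀≡0)) Σf≡0)

*-zero-cancelˡ : ∀ {p q} → 0ℚ < p → p * q ≡ 0ℚ → q ≡ 0ℚ
*-zero-cancelˡ {p} {q} 0<p pq≡0 with reciprocal 0<p
... | s , _ , sp≡1 = trans (sym (*-identityˡ q)) (trans (cong (_* q) (sym sp≡1))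
  (trans (*-assoc s p q) (trans (cong (s *_) pq≡0) (*-zeroʳ s))))

-- If no index of positive weight has a positive entry in the first row, all terms of that row are
-- nonpositive with sum zero, so the row vanishes at every index of positive weight. Whichever index
-- the remaining rows yield thus has first entry zero, and neither the family nor the weights have
-- to be restricted.
zero-or-lexPositive : ∀ m {k} (lam : Fin k → ℚ) (c : Fin k → Fin m → ℚ) →
  (∀ i → 0ℚ ≤ lam i) → ∃ (λ i → 0ℚ < lam i) →
  (∀ r → Σᶠ k (λ i → lam i * c i r) ≡ 0ℚ) →
  ∃ λ i → 0ℚ < lam i × ((∀ r → c i r ≡ 0ℚ) ⊎ LexPositive (c i))
zero-or-lexPositive zero lam c 0≤lam (i , 0<lamᵢ) avg = i , 0<lamᵢ , inj₁ λ ()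
zero-or-lexPositive (suc m) {k} lam c 0≤lam pos avg
  with any? (λ i → (0ℚ <? lam i) ×-dec (0ℚ <? c i zero))
... | yes (i , 0<lamᵢ , 0<c) = i , 0<lamᵢ , inj₂ (inj₁ 0<c)
... | no none = let i , 0<lamᵢ , rest = zero-or-lexPositive m lam (λ i → c i ∘ suc) 0≤lam pos (avg ∘ suc)
                    c₀≡0 = *-zero-cancelˡ 0<lamᵢ (Σᶠ-nonPositive-zero k term≤0 (avg zero) i)
                in i , 0<lamᵢ , Sum.map (λ z → λ { zero → c₀≡0 ; (suc r) → z r }) (λ l → inj₂ (c₀≡0 , l)) rest
  where
  term≤0 : ∀ i → lam i * c i zero ≤ 0ℚ
  term≤0 i with 0ℚ <? lam i
  ... | yes 0<lamᵢ = subst (lam i * c i zero ≤_) (*-zeroʳ (lam i))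
    (*-monoˡ-≤-nonNeg (lam i) {{nonNegative (0≤lam i)}} (≮⇒≥ λ 0<c → none (i , 0<lamᵢ , 0<c)))
  ... | no 0≮lamᵢ = ≤-reflexive (trans (cong (_* c i zero) (≤-antisym (≮⇒≥ 0≮lamᵢ) (0≤lam i))) (*-zeroˡ (c i zero)))

positive-weight : ∀ k {lam : Fin k → ℚ} → Σᶠ k lam ≡ 1ℚ → ∃ λ i → 0ℚ < lam i
positive-weight k {lam} Σ≡1 with any? (λ i → 0ℚ <? lam i)
... | yes p = p
... | no none = contradiction
  (subst₂ _≤_ Σ≡1 (Σᶠ-zero k λ _ → refl) (Σᶠ-mono-≤ k λ i → ≮⇒≥ λ 0<lamᵢ → none (i , 0<lamᵢ)))
  (λ 1≤0 → <-irrefl refl (<-≤-trans (positive⁻¹ 1ℚ) 1≤0))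

average-≤ : ∀ k {lam f : Fin k → ℚ} {B} → (∀ i → 0ℚ ≤ lam i) → Σᶠ k lam ≡ 1ℚ →
  (∀ i → f i ≤ B) → Σᶠ k (λ i → lam i * f i) ≤ B
average-≤ k {lam} {f} {B} 0≤lam Σ≡1 f≤B = ≤-trans
  (Σᶠ-mono-≤ k λ i → *-monoˡ-≤-nonNeg (lam i) {{nonNegative (0≤lam i)}} (f≤B i))
  (≤-reflexive (trans (Σᶠ-cong k λ i → *-comm (lam i) B)
    (trans (Σᶠ-scale k B lam) (trans (cong (B *_) Σ≡1) (*-identityʳ B)))))

average-≥ : ∀ k {lam f : Fin k → ℚ} {B} → (∀ i → 0ℚ ≤ lam i) → Σᶠ k lam ≡ 1ℚ →
  (∀ i → B ≤ f i) → B ≤ Σᶠ k (λ i → lam i * f i)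
average-≥ k {lam} {f} {B} 0≤lam Σ≡1 B≤f = ≤-trans
  (≤-reflexive (sym (trans (Σᶠ-cong k λ i → *-comm (lam i) B)
    (trans (Σᶠ-scale k B lam) (trans (cong (B *_) Σ≡1) (*-identityʳ B))))))
  (Σᶠ-mono-≤ k λ i → *-monoˡ-≤-nonNeg (lam i) {{nonNegative (0≤lam i)}} (B≤f i))

-- Convex hulls and box-integrality

convHull-mono : ∀ {n} {S T : Point n → Set} {x} → (∀ {y} → S y → T y) → ConvHull S x → ConvHull T x
convHull-mono S⊆T (k , z , lam , 0≤lam , Σ≡1 , z∈S , x≡) = k , z , lam , 0≤lam , Σ≡1 , S⊆T ∘ z∈S , x≡

convHull-point : ∀ {n} {S : Point n → Set} {x} → S x → ConvHull S x
convHull-point {x = x} x∈S =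
  1 , (λ _ → x) , (λ _ → 1ℚ) , (λ _ → nonNegative⁻¹ 1ℚ) , refl , (λ _ → x∈S) , λ j → lemma (x j)
  where
  lemma : ∀ x → x ≡ 1ℚ * x + 0ℚ
  lemma = solve-∀ ℚ-ring

convHull-segment : ∀ {n} {S : Point n → Set} {x y z} s t → 0ℚ ≤ s → 0ℚ ≤ t → s + t ≡ 1ℚ →
  x ≐ s ⊙ y ⊕ t ⊙ z → ConvHull S y → ConvHull S z → ConvHull S x
convHull-segment {n} {S} {x} s t 0≤s 0≤t s+t≡1 x≐
  (k , y , lam , 0≤lam , Σlam≡1 , y∈S , y≡) (l , z , mu , 0≤mu , Σmu≡1 , z∈S , z≡) =
  k ℕ.+ l , points ∘ splitAt k , weights ∘ splitAt k , weights-nonNeg ∘ splitAt k ,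
  trans (sum weights) (trans (cong₂ _+_ (trans (Σᶠ-scale k s lam) (trans (cong (s *_) Σlam≡1) (*-identityʳ s)))
                                        (trans (Σᶠ-scale l t mu) (trans (cong (t *_) Σmu≡1) (*-identityʳ t)))) s+t≡1) ,
  points∈S ∘ splitAt k ,
  λ j → trans (x≐ j) (sym (trans (sum (λ r → weights r * points r j)) (cong₂ _+_
    (trans (Σᶠ-cong k λ i → *-assoc s (lam i) (y i j))
      (trans (Σᶠ-scale k s (λ i → lam i * y i j)) (cong (s *_) (sym (y≡ j)))))
    (trans (Σᶠ-cong l λ i → *-assoc t (mu i) (z i j))
      (trans (Σᶠ-scale l t (λ i → mu i * z i j)) (cong (t *_) (sym (z≡ j))))))))
  where
  points : Fin k ⊎ Fin l → Point n
  points = [ y , z ]′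
  weights : Fin k ⊎ Fin l → ℚ
  weights = [ (λ i → s * lam i) , (λ i → t * mu i) ]′
  weights-nonNeg : ∀ r → 0ℚ ≤ weights r
  weights-nonNeg (inj₁ i) = 0≤* 0≤s (0≤lam i)
  weights-nonNeg (inj₂ i) = 0≤* 0≤t (0≤mu i)
  points∈S : ∀ r → S (points r)
  points∈S (inj₁ i) = y∈S i
  points∈S (inj₂ i) = z∈S i
  sum : ∀ (f : Fin k ⊎ Fin l → ℚ) →
    Σᶠ (k ℕ.+ l) (f ∘ splitAt k) ≡ Σᶠ k (f ∘ inj₁) + Σᶠ l (f ∘ inj₂)
  sum f = trans (Σᶠ-++ k l (f ∘ splitAt k)) (cong₂ _+_
    (Σᶠ-cong k λ i → cong f (splitAt-join k l (inj₁ i)))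
    (Σᶠ-cong l λ i → cong f (splitAt-join k l (inj₂ i))))

convHull-polyhedron : ∀ {n} (P : Polyhedron n) {x} → ConvHull (_∈P P) x → x ∈P P
convHull-polyhedron P (k , z , lam , 0≤lam , Σ≡1 , z∈P , x≡) i = ≤-trans
  (≤-reflexive (trans (dot-cong (A i) x≡) (dot-Σᶠ (A i) lam z)))
  (average-≤ k 0≤lam Σ≡1 λ r → z∈P r i)
  where open Polyhedron P

convHull-box : ∀ {n} {l u : Fin n → ℤ} {x} → ConvHull (WithinBox l u) x → WithinBox l u x
convHull-box (k , z , lam , 0≤lam , Σ≡1 , z∈B , x≡) j =
  subst (_ ≤_) (sym (x≡ j)) (average-≥ k 0≤lam Σ≡1 λ r → proj₁ (z∈B r j)) ,
  subst (_≤ _) (sym (x≡ j)) (average-≤ k 0≤lam Σ≡1 λ r → proj₂ (z∈B r j))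

BoxLattice : ∀ {n} → Polyhedron n → (l u : Fin n → ℤ) → Point n → Set
BoxLattice P l u y = (y ∈P P × WithinBox l u y) × IsIntegral y

-- The converse inclusion in the definition of box-integrality is convexity.
boxInteger-intro : ∀ {n} (P : Polyhedron n) →
  (∀ l u {x} → x ∈P P → WithinBox l u x → ConvHull (BoxLattice P l u) x) →
  IsBoxInteger P
boxInteger-intro P hull l u _ x = mk⇔
  (λ (x∈P , x∈B) → hull l u x∈P x∈B)
  (λ h → convHull-polyhedron P (convHull-mono {S = BoxLattice P l u} {T = _∈P P} (proj₁ ∘ proj₁) h) ,
         convHull-box {l = l} {u} (convHull-mono {S = BoxLattice P l u} {T = WithinBox l u} (proj₂ ∘ proj₁) h))

-- Rounding a recession direction by lexicographic descent

_≺_ : ∀ {m} → Vec ℕ m → Vec ℕ m → Set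
_≺_ = Lex-< _≡_ ℕ._<_

≺-wellFounded : ∀ {m} → WellFounded (_≺_ {m})
≺-wellFounded = Lex.<-wellFounded trans (subst _) ℕ.<-wellFounded

lexPositive⇒≺ : ∀ {m} (c : Fin m → ℚ) (v u : Fin m → ℕ) →
  (∀ k → 0ℚ < c k → v k ℕ.< u k) → (∀ k → c k ≡ 0ℚ → v k ≡ u k) →
  LexPositive c → tabulate v ≺ tabulate u
lexPositive⇒≺ {suc m} c v u < ≈ (inj₁ 0<c₀) = this (< zero 0<c₀) refl
lexPositive⇒≺ {suc m} c v u < ≈ (inj₂ (c₀≡0 , rest)) =
  next (≈ zero c₀≡0) (lexPositive⇒≺ (c ∘ suc) (v ∘ suc) (u ∘ suc) (< ∘ suc) (≈ ∘ suc) rest)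

floor≤ceiling : ∀ q → floor q ℤ.≤ ceiling q
floor≤ceiling q = fromℤ-cancel-≤ (≤-trans (floor-≤ q) (≤-ceiling q))

within-floor-ceiling : ∀ {n} (x : Point n) → WithinBox (floor ∘ x) (ceiling ∘ x) x
within-floor-ceiling x j = floor-≤ (x j) , ≤-ceiling (x j)

-- The integer box around any point of `P` expresses that point through integral points of `P`, and
-- since the weights sum to one there is at least one of them.
integral-point : ∀ {n} (P : Polyhedron n) → Nonempty P → IsBoxInteger P → ∃ λ p → IsIntegral p × p ∈P P
integral-point P (x , x∈P) box
  with Equivalence.to (box (floor ∘ x) (ceiling ∘ x) (floor≤ceiling ∘ x) x) (x∈P , within-floor-ceiling x)
... | k , z , lam , _ , Σ≡1 , z∈S , _ with positive-weight k Σ≡1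
... | i , _ = z i , proj₂ (z∈S i) , proj₁ (proj₁ (z∈S i))

dot-difference : ∀ {n} (g z p : Point n) → dot g (z ⊕ (- 1ℚ) ⊙ p) ≡ dot g z - dot g p
dot-difference g z p = trans (dot-⊕ g z ((- 1ℚ) ⊙ p)) (cong (dot g z +_)
  (trans (dot-⊙ g (- 1ℚ) p) (lemma (dot g p))))
  where
  lemma : ∀ x → - 1ℚ * x ≡ - x
  lemma = solve-∀ ℚ-ring

module _ {n} (P : Polyhedron n) (P-box : IsBoxInteger P)
  {m} (G : Fin m → Point n) (β : Fin m → ℚ) (P≤β : ∀ {y} → y ∈P P → ∀ k → dot (G k) y ≤ β k)
  {x} (x∈rec : x ∈P recession P) (Gx≡0 : ∀ k → dot (G k) x ≡ 0ℚ) where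

  open Polyhedron P using (A; b)

  Rounding : Set
  Rounding = ∃ λ w → IsIntegral w × WithinBox (floor ∘ x) (ceiling ∘ x) w × ∀ k → dot (G k) w ≡ 0ℚ

  slacks : Point n → Fin m → ℕ
  slacks p k = proj₁ (slack-measure (G k) (β k)) p

  shift-recession : ∀ {p} → p ∈P P → (p ⊕ x) ∈P P
  shift-recession {p} p∈P i = 0≤-⇒≤ _ (0≤+ (≤⇒0≤- (p∈P i)) (≤⇒0≤- (x∈rec i)))
    (trans (cong (λ d → b i - d) (dot-⊕ (A i) p x)) (lemma (b i) (dot (A i) p) (dot (A i) x)))
    where
    lemma : ∀ b p x → b - (p + x) ≡ (b - p) + (0ℚ - x)
    lemma = solve-∀ ℚ-ring

  Exchange : Point n → Set
  Exchange p = ∃ λ z → IsIntegral z × z ∈P P × WithinBox (floor ∘ x) (ceiling ∘ x) (z ⊕ (- 1ℚ) ⊙ p) ×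
    ((∀ r → dot (G r) z - dot (G r) p ≡ 0ℚ) ⊎ LexPositive (λ r → dot (G r) z - dot (G r) p))

  module _ {p} (p∈ℤ : IsIntegral p) (p∈P : p ∈P P) where

    lower upper : Fin n → ℤ
    lower j = proj₁ (p∈ℤ j) ℤ.+ floor (x j)
    upper j = proj₁ (p∈ℤ j) ℤ.+ ceiling (x j)

    fromℤ-lower : ∀ j → fromℤ (lower j) ≡ p j + fromℤ (floor (x j))
    fromℤ-lower j = trans (fromℤ-+ (proj₁ (p∈ℤ j)) (floor (x j)))
      (cong (_+ fromℤ (floor (x j))) (sym (proj₂ (p∈ℤ j))))

    fromℤ-upper : ∀ j → fromℤ (upper j) ≡ p j + fromℤ (ceiling (x j))
    fromℤ-upper j = trans (fromℤ-+ (proj₁ (p∈ℤ j)) (ceiling (x j)))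
      (cong (_+ fromℤ (ceiling (x j))) (sym (proj₂ (p∈ℤ j))))

    -- Integrality of `p` is what makes the corners of the translated box integral, so that
    -- box-integrality of `P` applies to it.
    shifted-hull : ConvHull (BoxLattice P lower upper) (p ⊕ x)
    shifted-hull = Equivalence.to
      (P-box lower upper (λ j → ℤ.+-monoʳ-≤ (proj₁ (p∈ℤ j)) (floor≤ceiling (x j))) (p ⊕ x))
      (shift-recession p∈P , λ j →
        subst (_≤ p j + x j) (sym (fromℤ-lower j)) (+-monoʳ-≤ (p j) (floor-≤ (x j))) ,
        subst (p j + x j ≤_) (sym (fromℤ-upper j)) (+-monoʳ-≤ (p j) (≤-ceiling (x j))))

    unshift : ∀ {z} → WithinBox lower upper z → WithinBox (floor ∘ x) (ceiling ∘ x) (z ⊕ (- 1ℚ) ⊙ p)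
    unshift {z} z∈B j =
      0≤-⇒≤ _ (≤⇒0≤- (subst (_≤ z j) (fromℤ-lower j) (proj₁ (z∈B j)))) (lemma (z j) (p j) (fromℤ (floor (x j)))) ,
      0≤-⇒≤ _ (≤⇒0≤- (subst (z j ≤_) (fromℤ-upper j) (proj₂ (z∈B j)))) (lemma′ (z j) (p j) (fromℤ (ceiling (x j))))
      where
      lemma : ∀ z p f → (z + - 1ℚ * p) - f ≡ z - (p + f)
      lemma = solve-∀ ℚ-ring
      lemma′ : ∀ z p f → f - (z + - 1ℚ * p) ≡ (p + f) - z
      lemma′ = solve-∀ ℚ-ring

    -- The mean of the points `z i` is p + x, and every row of `G` vanishes on x.
    average-zero : ∀ {k} {lam : Fin k → ℚ} {z : Fin k → Point n} → Σᶠ k lam ≡ 1ℚ →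
      (∀ j → p j + x j ≡ Σᶠ k (λ i → lam i * z i j)) →
      ∀ r → Σᶠ k (λ i → lam i * (dot (G r) (z i) - dot (G r) p)) ≡ 0ℚ
    average-zero {k} {lam} {z} Σ≡1 p⊕x≡ r = begin
      Σᶠ k (λ i → lam i * (dot (G r) (z i) - π))
        ≡⟨ Σᶠ-cong k (λ i → lemma (lam i) (dot (G r) (z i)) π) ⟩
      Σᶠ k (λ i → 1ℚ * (lam i * dot (G r) (z i)) + - π * lam i)
        ≡⟨ Σᶠ-linear k 1ℚ (- π) (λ i → lam i * dot (G r) (z i)) lam ⟩
      1ℚ * Σᶠ k (λ i → lam i * dot (G r) (z i)) + - π * Σᶠ k lam
        ≡⟨ cong₂ (λ s t → 1ℚ * s + - π * t) (sym (trans (dot-cong (G r) p⊕x≡) (dot-Σᶠ (G r) lam z))) Σ≡1 ⟩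
      1ℚ * dot (G r) (p ⊕ x) + - π * 1ℚ
        ≡⟨ cong (λ s → 1ℚ * s + - π * 1ℚ) (trans (dot-⊕ (G r) p x) (cong (π +_) (Gx≡0 r))) ⟩
      1ℚ * (π + 0ℚ) + - π * 1ℚ
        ≡⟨ lemma′ π ⟩
      0ℚ ∎
      where
      open ≡-Reasoning
      π = dot (G r) p
      lemma : ∀ l z π → l * (z - π) ≡ 1ℚ * (l * z) + - π * l
      lemma = solve-∀ ℚ-ring
      lemma′ : ∀ π → 1ℚ * (π + 0ℚ) + - π * 1ℚ ≡ 0ℚ
      lemma′ = solve-∀ ℚ-ring

    exchange : Exchange p
    exchange = choose shifted-hull
      where
      choose : ConvHull (BoxLattice P lower upper) (p ⊕ x) → Exchange p
      choose (k , z , lam , 0≤lam , Σ≡1 , z∈S , p⊕x≡) =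
        let i , _ , outcome = zero-or-lexPositive m lam (λ i r → dot (G r) (z i) - dot (G r) p)
                                0≤lam (positive-weight k Σ≡1) (average-zero {z = z} Σ≡1 p⊕x≡)
        in z i , proj₂ (z∈S i) , proj₁ (proj₁ (z∈S i)) , unshift (proj₂ (proj₁ (z∈S i))) , outcome

    -- A larger value of a row is a smaller slack, so a first difference that is positive lowers the
    -- first slack that changes.
    slacks-decrease : ∀ {z} → IsIntegral z → z ∈P P →
      LexPositive (λ r → dot (G r) z - dot (G r) p) → tabulate (slacks z) ≺ tabulate (slacks p)
    slacks-decrease {z} z∈ℤ z∈P = lexPositive⇒≺ (λ r → dot (G r) z - dot (G r) p) (slacks z) (slacks p)
      (λ r 0<c → proj₁ (proj₂ (slack-measure (G r) (β r)) p∈ℤ z∈ℤ (P≤β p∈P r) (P≤β z∈P r))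
        (subst₂ _<_ (+-identityˡ _) (cancel (dot (G r) z) (dot (G r) p)) (+-monoˡ-< (dot (G r) p) 0<c)))
      (λ r c≡0 → sym $ proj₂ (proj₂ (slack-measure (G r) (β r)) z∈ℤ p∈ℤ (P≤β z∈P r) (P≤β p∈P r))
        (trans (sym (cancel (dot (G r) z) (dot (G r) p))) (trans (cong (_+ dot (G r) p) c≡0) (+-identityˡ _))))
      where
      cancel : ∀ u v → (u - v) + v ≡ u
      cancel = solve-∀ ℚ-ring

  -- An integral point p of P is exchanged for lexicographically better ones among the integral
  -- points around p + x; when none is better, one of them differs from p by a vector on which G vanishes.
  rounding-from : ∀ {p} → IsIntegral p → p ∈P P → Acc _≺_ (tabulate (slacks p)) → Rounding
  rounding-from {p} p∈ℤ p∈P (acc smaller) = continue (exchange p∈ℤ p∈P)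
    where
    continue : Exchange p → Rounding
    continue (z , z∈ℤ , z∈P , w∈B , inj₁ tight) = z ⊕ (- 1ℚ) ⊙ p ,
      (λ j → integral-+ (z∈ℤ j) (integral-* (ℤ.- 1ℤ , refl) (p∈ℤ j))) , w∈B ,
      λ r → trans (dot-difference (G r) z p) (tight r)
    continue (z , z∈ℤ , z∈P , w∈B , inj₂ better) =
      rounding-from z∈ℤ z∈P (smaller (slacks-decrease p∈ℤ p∈P z∈ℤ z∈P better))

  rounding : Nonempty P → Rounding
  rounding P≢∅ with integral-point P P≢∅ P-box
  ... | p , p∈ℤ , p∈P = rounding-from p∈ℤ p∈P (≺-wellFounded (tabulate (slacks p)))

-- Ratio test and counting of nonzero residuals

*≤0 : ∀ {p q} → 0ℚ ≤ p → q ≤ 0ℚ → p * q ≤ 0ℚ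
*≤0 {p} {q} 0≤p q≤0 = subst (p * q ≤_) (*-zeroʳ p) (*-monoˡ-≤-nonNeg p {{nonNegative 0≤p}} q≤0)

-- The ratio test of the simplex method, with slacks s and growth rates g.
ratio-test : ∀ N (s g : Fin N → ℚ) → (∀ i → 0ℚ ≤ s i) → (∀ i → s i ≡ 0ℚ → g i ≡ 0ℚ) →
  (∀ i → g i ≤ 0ℚ) ⊎
  ∃ λ t → 0ℚ < t × (∀ i → t * g i ≤ s i) × ∃ λ i → 0ℚ < g i × t * g i ≡ s i
ratio-test zero    s g 0≤s tight = inj₁ λ ()
ratio-test (suc N) s g 0≤s tight with ratio-test N (s ∘ suc) (g ∘ suc) (0≤s ∘ suc) (tight ∘ suc) | g zero ≤? 0ℚ
... | inj₁ g≤0 | yes g₀≤0 = inj₁ λ { zero → g₀≤0 ; (suc i) → g≤0 i }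
... | inj₂ (t , 0<t , tg≤s , i , 0<gᵢ , eq) | yes g₀≤0 = inj₂
  (t , 0<t , (λ { zero → ≤-trans (*≤0 (<⇒≤ 0<t) g₀≤0) (0≤s zero) ; (suc i) → tg≤s i }) , suc i , 0<gᵢ , eq)
... | tail | no g₀≰0 with reciprocal (≰⇒> g₀≰0)
... | v , 0<v , vg₀≡1 = inj₂ (compare tail)
  where
  0<g₀ : 0ℚ < g zero
  0<g₀ = ≰⇒> g₀≰0
  t₀ = s zero * v
  -- A vanishing slack would force zero growth by `tight`. This is what keeps the step length
  -- positive.
  0<s₀ : 0ℚ < s zero
  0<s₀ with <-cmp 0ℚ (s zero)
  ... | tri< 0<s₀ _ _ = 0<s₀
  ... | tri≈ _ 0≡s₀ _ = contradiction (tight zero (sym 0≡s₀)) (λ g₀≡0 → g₀≰0 (≤-reflexive g₀≡0))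
  ... | tri> _ _ s₀<0 = contradiction (≤-<-trans (0≤s zero) s₀<0) (<-irrefl refl)
  0<t₀ : 0ℚ < t₀
  0<t₀ = 0<* 0<s₀ 0<v
  t₀g₀≡s₀ : t₀ * g zero ≡ s zero
  t₀g₀≡s₀ = trans (*-assoc (s zero) v (g zero)) (trans (cong (s zero *_) vg₀≡1) (*-identityʳ (s zero)))
  Step = ∃ λ t → 0ℚ < t × (∀ i → t * g i ≤ s i) × ∃ λ i → 0ℚ < g i × t * g i ≡ s i
  compare : _ → Step
  compare (inj₁ g≤0) = t₀ , 0<t₀ ,
    (λ { zero → ≤-reflexive t₀g₀≡s₀ ; (suc i) → ≤-trans (*≤0 (<⇒≤ 0<t₀) (g≤0 i)) (0≤s (suc i)) }) ,
    zero , 0<g₀ , t₀g₀≡s₀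
  compare (inj₂ (t , 0<t , tg≤s , i , 0<gᵢ , eq)) with t ≤? t₀
  ... | yes t≤t₀ = t , 0<t ,
    (λ { zero → ≤-trans (*-monoʳ-≤-nonNeg (g zero) {{nonNegative (<⇒≤ 0<g₀)}} t≤t₀) (≤-reflexive t₀g₀≡s₀)
       ; (suc i) → tg≤s i }) , suc i , 0<gᵢ , eq
  ... | no t≰t₀ = t₀ , 0<t₀ , (λ { zero → ≤-reflexive t₀g₀≡s₀ ; (suc i) → shorter i }) , zero , 0<g₀ , t₀g₀≡s₀
    where
    shorter : ∀ i → t₀ * g (suc i) ≤ s (suc i)
    shorter i with g (suc i) ≤? 0ℚ
    ... | yes gᵢ≤0 = ≤-trans (*≤0 (<⇒≤ 0<t₀) gᵢ≤0) (0≤s (suc i))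
    ... | no gᵢ≰0 = ≤-trans
      (*-monoʳ-≤-nonNeg (g (suc i)) {{nonNegative (<⇒≤ (≰⇒> gᵢ≰0))}} (<⇒≤ (≰⇒> t≰t₀))) (tg≤s i)

#nonzero : ∀ N → (Fin N → ℚ) → ℕ
#nonzero zero    f = 0
#nonzero (suc N) f with f zero ≟ 0ℚ
... | yes _ = #nonzero N (f ∘ suc)
... | no  _ = suc (#nonzero N (f ∘ suc))

#nonzero-mono-≤ : ∀ N {f g : Fin N → ℚ} → (∀ i → f i ≡ 0ℚ → g i ≡ 0ℚ) → #nonzero N g ℕ.≤ #nonzero N f
#nonzero-mono-≤ zero    f⇒g = z≤n
#nonzero-mono-≤ (suc N) {f} {g} f⇒g with #nonzero-mono-≤ N (f⇒g ∘ suc) | f zero ≟ 0ℚ | g zero ≟ 0ℚ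
... | le | yes _    | yes _    = le
... | le | yes f₀≡0 | no g₀≢0  = contradiction (f⇒g zero f₀≡0) g₀≢0
... | le | no _     | yes _    = ℕ.m≤n⇒m≤1+n le
... | le | no _     | no _     = s≤s le

#nonzero-mono-< : ∀ N {f g : Fin N → ℚ} → (∀ i → f i ≡ 0ℚ → g i ≡ 0ℚ) →
  ∀ i → f i ≢ 0ℚ → g i ≡ 0ℚ → #nonzero N g ℕ.< #nonzero N f
#nonzero-mono-< (suc N) {f} {g} f⇒g zero f₀≢0 g₀≡0 with f zero ≟ 0ℚ | g zero ≟ 0ℚ
... | yes f₀≡0 | _        = contradiction f₀≡0 f₀≢0
... | no _     | yes _    = s≤s (#nonzero-mono-≤ N (f⇒g ∘ suc))
... | no _     | no g₀≢0  = contradiction g₀≡0 g₀≢0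
#nonzero-mono-< (suc N) {f} {g} f⇒g (suc i) fᵢ≢0 gᵢ≡0
  with #nonzero-mono-< N (f⇒g ∘ suc) i fᵢ≢0 gᵢ≡0 | f zero ≟ 0ℚ | g zero ≟ 0ℚ
... | lt | yes _    | yes _    = lt
... | lt | yes f₀≡0 | no g₀≢0  = contradiction (f⇒g zero f₀≡0) g₀≢0
... | lt | no _     | yes _    = ℕ.m≤n⇒m≤1+n lt
... | lt | no _     | no _     = s≤s lt

-- Intersection of a polyhedron with an integer box

unit : ∀ {n} → Fin n → Point n
unit zero    = 1ℚ Vector.∷ 𝟎
unit (suc i) = 0ℚ Vector.∷ unit i

dot-unit : ∀ {n} (i : Fin n) x → dot (unit i) x ≡ x i
dot-unit {suc n} zero    x = trans (cong (1ℚ * x zero +_) (Σᶠ-zero n λ j → *-zeroˡ (x (suc j)))) (lemma (x zero))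
  where
  lemma : ∀ x → 1ℚ * x + 0ℚ ≡ x
  lemma = solve-∀ ℚ-ring
dot-unit {suc n} (suc i) x = trans (cong (0ℚ * x zero +_) (dot-unit i (x ∘ suc))) (lemma (x zero) (x (suc i)))
  where
  lemma : ∀ x y → 0ℚ * x + y ≡ y
  lemma = solve-∀ ℚ-ring

dot-neg-unit : ∀ {n} (i : Fin n) x → dot ((- 1ℚ) ⊙ unit i) x ≡ - x i
dot-neg-unit {n} i x = trans (Σᶠ-cong n λ j → *-assoc (- 1ℚ) (unit i j) (x j))
  (trans (Σᶠ-scale n (- 1ℚ) (λ j → unit i j * x j)) (trans (cong (- 1ℚ *_) (dot-unit i x)) (lemma (x i))))
  where
  lemma : ∀ x → - 1ℚ * x ≡ - x
  lemma = solve-∀ ℚ-ring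

module Boxed {n} (P : Polyhedron n) where
  open Polyhedron P using (m; A; b)

  -- Constraints of `P`, upper bounds and lower bounds, kept apart for case analysis; `toRow` and
  -- `fromRow` mediate with the plain index set of a polyhedron.
  Row : Set
  Row = Fin m ⊎ Fin n ⊎ Fin n

  #rows : ℕ
  #rows = m ℕ.+ (n ℕ.+ n)

  toRow : Fin #rows → Row
  toRow i = Sum.map₂ (splitAt n) (splitAt m i)

  fromRow : Row → Fin #rows
  fromRow r = join m (n ℕ.+ n) (Sum.map₂ (join n n) r)

  toRow-fromRow : ∀ r → toRow (fromRow r) ≡ r
  toRow-fromRow r = trans (cong (Sum.map₂ (splitAt n)) (splitAt-join m (n ℕ.+ n) (Sum.map₂ (join n n) r))) (lemma r)
    where
    lemma : ∀ r → Sum.map₂ (splitAt n) (Sum.map₂ (join n n) r) ≡ r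
    lemma (inj₁ k) = refl
    lemma (inj₂ r) = cong inj₂ (splitAt-join n n r)

  rowVector : Row → Point n
  rowVector (inj₁ k)        = A k
  rowVector (inj₂ (inj₁ j)) = unit j
  rowVector (inj₂ (inj₂ j)) = (- 1ℚ) ⊙ unit j

  rowBound : (l u : Fin n → ℤ) → Row → ℚ
  rowBound l u (inj₁ k)        = b k
  rowBound l u (inj₂ (inj₁ j)) = fromℤ (u j)
  rowBound l u (inj₂ (inj₂ j)) = - fromℤ (l j)

  boxed : (l u : Fin n → ℤ) → Polyhedron n
  boxed l u = record { m = #rows ; A = rowVector ∘ toRow ; b = rowBound l u ∘ toRow }

  rows⇒∈ : ∀ {l u x} → (∀ r → dot (rowVector r) x ≤ rowBound l u r) → x ∈P P × WithinBox l u x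
  rows⇒∈ {l} {u} {x} h = h ∘ inj₁ , λ j →
    0≤-⇒≤ _ (≤⇒0≤- (subst (_≤ - fromℤ (l j)) (dot-neg-unit j x) (h (inj₂ (inj₂ j))))) (lemma (x j) (fromℤ (l j))) ,
    subst (_≤ fromℤ (u j)) (dot-unit j x) (h (inj₂ (inj₁ j)))
    where
    lemma : ∀ x l → x - l ≡ - l - - x
    lemma = solve-∀ ℚ-ring

  ∈⇒rows : ∀ {l u x} → x ∈P P → WithinBox l u x → ∀ r → dot (rowVector r) x ≤ rowBound l u r
  ∈⇒rows x∈P x∈B (inj₁ k) = x∈P k
  ∈⇒rows {u = u} {x} x∈P x∈B (inj₂ (inj₁ j)) = subst (_≤ fromℤ (u j)) (sym (dot-unit j x)) (proj₂ (x∈B j))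
  ∈⇒rows {l} {x = x} x∈P x∈B (inj₂ (inj₂ j)) =
    subst (_≤ - fromℤ (l j)) (sym (dot-neg-unit j x)) (neg-antimono-≤ (proj₁ (x∈B j)))

  ∈boxed⇒∈ : ∀ {l u x} → x ∈P boxed l u → x ∈P P × WithinBox l u x
  ∈boxed⇒∈ {l} {u} {x} h = rows⇒∈ λ r →
    subst (λ r → dot (rowVector r) x ≤ rowBound l u r) (toRow-fromRow r) (h (fromRow r))

  ∈⇒∈boxed : ∀ {l u x} → x ∈P P → WithinBox l u x → x ∈P boxed l u
  ∈⇒∈boxed {l} {u} x∈P x∈B i = ∈⇒rows {l} {u} x∈P x∈B (toRow i)

  -- Two integer boxes meet in the integer box whose corners are the maxima of the lower and the
  -- minima of the upper bounds. The given point in it shows that these corners are in order.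
  boxed-boxInteger : IsBoxInteger P → ∀ l u → IsBoxInteger (boxed l u)
  boxed-boxInteger P-box l u = boxInteger-intro (boxed l u) hull
    where
    hull : ∀ l′ u′ {x} → x ∈P boxed l u → WithinBox l′ u′ x → ConvHull (BoxLattice (boxed l u) l′ u′) x
    hull l′ u′ {x} x∈R x∈B′ = convHull-mono {S = BoxLattice P l″ u″} {T = BoxLattice (boxed l u) l′ u′} split-box
      (Equivalence.to
        (P-box l″ u″ (λ j → fromℤ-cancel-≤ (≤-trans (proj₁ (x∈B″ j)) (proj₂ (x∈B″ j)))) x)
        (proj₁ x∈P×B , x∈B″))
      where
      x∈P×B = ∈boxed⇒∈ {l} {u} x∈R
      l″ u″ : Fin n → ℤ
      l″ j = l j ℤ.⊔ l′ j
      u″ j = u j ℤ.⊓ u′ j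
      x∈B″ : WithinBox l″ u″ x
      x∈B″ j =
        [ (λ eq → subst (λ v → fromℤ v ≤ x j) (sym eq) (proj₁ (proj₂ x∈P×B j))) ,
          (λ eq → subst (λ v → fromℤ v ≤ x j) (sym eq) (proj₁ (x∈B′ j))) ]′ (ℤ.⊔-sel (l j) (l′ j)) ,
        [ (λ eq → subst (λ v → x j ≤ fromℤ v) (sym eq) (proj₂ (proj₂ x∈P×B j))) ,
          (λ eq → subst (λ v → x j ≤ fromℤ v) (sym eq) (proj₂ (x∈B′ j))) ]′ (ℤ.⊓-sel (u j) (u′ j))
      split-box : ∀ {y} → BoxLattice P l″ u″ y → BoxLattice (boxed l u) l′ u′ y
      split-box ((y∈P , y∈B) , y∈ℤ) =
        (∈⇒∈boxed {l} {u} y∈P (λ j → ≤-trans (fromℤ-mono-≤ (ℤ.i≤i⊔j (l j) (l′ j))) (proj₁ (y∈B j)) ,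
                                     ≤-trans (proj₂ (y∈B j)) (fromℤ-mono-≤ (ℤ.i⊓j≤i (u j) (u′ j)))) ,
         λ j → ≤-trans (fromℤ-mono-≤ (ℤ.i≤j⊔i (l j) (l′ j))) (proj₁ (y∈B j)) ,
               ≤-trans (proj₂ (y∈B j)) (fromℤ-mono-≤ (ℤ.i⊓j≤j (u j) (u′ j)))) , y∈ℤ

-- Box-integrality of the recession cone

module RecessionCone {n} (P : Polyhedron n) (P≢∅ : Nonempty P) (P-box : IsBoxInteger P) where
  open Polyhedron P using (m; A; b)
  open Boxed (recession P)

  C : Polyhedron n
  C = recession P

  slack : Point n → Point n → Row → ℚ
  slack x y r = rowBound (floor ∘ x) (ceiling ∘ x) r - dot (rowVector r) y

  -- The residual in the row of a coordinate vanishes exactly when that coordinate is integral.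
  residual : Point n → Row → ℚ
  residual x = slack x x

  p-q≡0⇒p≡q : ∀ {p q} → p - q ≡ 0ℚ → p ≡ q
  p-q≡0⇒p≡q {p} {q} eq = trans (sym (lemma p q)) (trans (cong (_+ q) eq) (+-identityˡ q))
    where
    lemma : ∀ p q → (p - q) + q ≡ p
    lemma = solve-∀ ℚ-ring

  slack-upper : ∀ {x y j} → slack x y (inj₂ (inj₁ j)) ≡ 0ℚ → Integral (y j)
  slack-upper {x} {y} {j} eq = ceiling (x j) , trans (sym (dot-unit j y)) (sym (p-q≡0⇒p≡q eq))

  slack-lower : ∀ {x y j} → slack x y (inj₂ (inj₂ j)) ≡ 0ℚ → Integral (y j)
  slack-lower {x} {y} {j} eq =
    floor (x j) , neg-injective (trans (sym (dot-neg-unit j y)) (sym (p-q≡0⇒p≡q eq)))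

  -- The residual at `y` refers to the integer box around `y` and not to the one around `x`. A
  -- coordinate of `y` on a face of the old box is integral, hence its own floor and ceiling, and so
  -- it is tight in the new box too.
  tight-persists : ∀ {x y} r → slack x y r ≡ 0ℚ → residual y r ≡ 0ℚ
  tight-persists (inj₁ k) eq = eq
  tight-persists {x} {y} (inj₂ (inj₁ j)) eq =
    trans (cong₂ _-_ (sym (integral⇒ceiling (slack-upper {x} {y} eq))) (dot-unit j y)) (+-inverseʳ (y j))
  tight-persists {x} {y} (inj₂ (inj₂ j)) eq =
    trans (cong₂ _-_ (cong -_ (sym (integral⇒floor (slack-lower {x} {y} eq)))) (dot-neg-unit j y)) (+-inverseʳ (- y j))

  record Advance (x d : Point n) : Set where
    field
      t        : ℚ
      0<t      : 0ℚ < t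
      inCone   : (x ⊕ t ⊙ d) ∈P C
      inBox    : WithinBox (floor ∘ x) (ceiling ∘ x) (x ⊕ t ⊙ d)
      progress : #nonzero #rows (residual (x ⊕ t ⊙ d) ∘ toRow) ℕ.< #nonzero #rows (residual x ∘ toRow)

  -- Rows tight at `x` are constant along `d` and remain tight; the increasing row stops the motion,
  -- and the row blocking it, not tight before because it grows, becomes tight. So fewer residuals
  -- are nonzero.
  advance : ∀ {x d} → x ∈P C → (∀ r → residual x r ≡ 0ℚ → dot (rowVector r) d ≡ 0ℚ) →
    ∃ (λ r → 0ℚ < dot (rowVector r) d) → Advance x d
  advance {x} {d} x∈C tight (r , 0<r) with
    ratio-test #rows (residual x ∘ toRow) (λ i → dot (rowVector (toRow i)) d)
      (λ i → ≤⇒0≤- (∈⇒rows x∈C (within-floor-ceiling x) (toRow i))) (λ i → tight (toRow i))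
  ... | inj₁ none = contradiction
    (<-≤-trans 0<r (subst (λ r → dot (rowVector r) d ≤ 0ℚ) (toRow-fromRow r) (none (fromRow r))))
    (<-irrefl refl)
  ... | inj₂ (t , 0<t , td≤ , i , 0<i , eq) = record
    { t = t ; 0<t = 0<t ; inCone = proj₁ inside ; inBox = proj₂ inside
    ; progress = #nonzero-mono-< #rows
        (λ i′ res≡0 → tight-persists {x} (toRow i′) (trans (slack-move (toRow i′))
          (trans (cong₂ (λ s g → s - t * g) res≡0 (tight (toRow i′) res≡0)) (0-t0 t))))
        i (λ res≡0 → <-irrefl (sym (tight (toRow i) res≡0)) 0<i)
        (tight-persists {x} (toRow i) (trans (slack-move (toRow i))
          (trans (cong (λ v → residual x (toRow i) - v) eq) (+-inverseʳ (residual x (toRow i))))))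
    }
    where
    0-t0 : ∀ t → 0ℚ - t * 0ℚ ≡ 0ℚ
    0-t0 = solve-∀ ℚ-ring
    slack-move : ∀ r → slack x (x ⊕ t ⊙ d) r ≡ residual x r - t * dot (rowVector r) d
    slack-move r = trans (cong (λ v → rowBound (floor ∘ x) (ceiling ∘ x) r - v)
        (trans (dot-⊕ (rowVector r) x (t ⊙ d)) (cong (dot (rowVector r) x +_) (dot-⊙ (rowVector r) t d))))
      (lemma (rowBound (floor ∘ x) (ceiling ∘ x) r) (dot (rowVector r) x) (t * dot (rowVector r) d))
      where
      lemma : ∀ b v g → b - (v + g) ≡ (b - v) - g
      lemma = solve-∀ ℚ-ring
    inside : (x ⊕ t ⊙ d) ∈P C × WithinBox (floor ∘ x) (ceiling ∘ x) (x ⊕ t ⊙ d)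
    inside = rows⇒∈ λ r → 0≤-⇒≤ _
      (≤⇒0≤- (subst (λ r → t * dot (rowVector r) d ≤ residual x r) (toRow-fromRow r) (td≤ (fromRow r))))
      (slack-move r)

  module _ {x} (x∈C : x ∈P C) where

    -- Rows that are slack at `x` are replaced by the trivial inequality 0 ≤ 0 and not dropped,
    -- which keeps `Fin m` as the index set.
    tightVector : Fin m → Point n
    tightVector k with dot (A k) x ≟ 0ℚ
    ... | yes _ = A k
    ... | no  _ = 𝟎

    tightBound : Fin m → ℚ
    tightBound k with dot (A k) x ≟ 0ℚ
    ... | yes _ = b k
    ... | no  _ = 0ℚ

    P≤tightBound : ∀ {y} → y ∈P P → ∀ k → dot (tightVector k) y ≤ tightBound k
    P≤tightBound {y} y∈P k with dot (A k) x ≟ 0ℚ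
    ... | yes _ = y∈P k
    ... | no  _ = ≤-reflexive (Σᶠ-zero n λ j → *-zeroˡ (y j))

    tightVector-zero : ∀ k → dot (tightVector k) x ≡ 0ℚ
    tightVector-zero k with dot (A k) x ≟ 0ℚ
    ... | yes eq = eq
    ... | no  _  = Σᶠ-zero n λ j → *-zeroˡ (x j)

    tightVector-tight : ∀ k → dot (A k) x ≡ 0ℚ → ∀ y → dot (tightVector k) y ≡ dot (A k) y
    tightVector-tight k eq y with dot (A k) x ≟ 0ℚ
    ... | yes _  = refl
    ... | no neq = contradiction eq neq

    tight-rounding : Rounding P P-box tightVector tightBound P≤tightBound x∈C tightVector-zero
    tight-rounding = rounding P P-box tightVector tightBound P≤tightBound x∈C tightVector-zero P≢∅

    w : Point n
    w = proj₁ tight-rounding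

    w∈ℤ : IsIntegral w
    w∈ℤ = proj₁ (proj₂ tight-rounding)

    w∈B : WithinBox (floor ∘ x) (ceiling ∘ x) w
    w∈B = proj₁ (proj₂ (proj₂ tight-rounding))

    d : Point n
    d = w ⊕ (- 1ℚ) ⊙ x

    -- At an integral coordinate the box around `x` degenerates to a single value, which `w` and `x`
    -- share.
    d-integral : ∀ {j} → Integral (x j) → d j ≡ 0ℚ
    d-integral {j} xⱼ∈ℤ = trans (cong (_+ - 1ℚ * x j) w≡x) (lemma (x j))
      where
      w≡x : w j ≡ x j
      w≡x = ≤-antisym (subst (w j ≤_) (sym (integral⇒ceiling xⱼ∈ℤ)) (proj₂ (w∈B j)))
                      (subst (_≤ w j) (sym (integral⇒floor xⱼ∈ℤ)) (proj₁ (w∈B j)))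
      lemma : ∀ x → x + - 1ℚ * x ≡ 0ℚ
      lemma = solve-∀ ℚ-ring

    d-fractional : ∀ {j} → ¬ Integral (x j) → d j ≢ 0ℚ
    d-fractional {j} xⱼ∉ℤ dⱼ≡0 = xⱼ∉ℤ (subst Integral w≡x (w∈ℤ j))
      where
      lemma : ∀ w x → w ≡ (w + - 1ℚ * x) + x
      lemma = solve-∀ ℚ-ring
      w≡x : w j ≡ x j
      w≡x = trans (lemma (w j) (x j)) (trans (cong (_+ x j) dⱼ≡0) (+-identityˡ (x j)))

    -- A tight row of the cone vanishes on `w` by the rounding and on `x` by tightness; a tight row
    -- of the box belongs to an integral coordinate.
    d-tight : ∀ r → residual x r ≡ 0ℚ → dot (rowVector r) d ≡ 0ℚ
    d-tight (inj₁ k) eq = trans (dot-difference (A k) w x) (cong₂ _-_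
      (trans (sym (tightVector-tight k Aₖx≡0 w)) (proj₂ (proj₂ (proj₂ tight-rounding)) k)) Aₖx≡0)
      where
      Aₖx≡0 : dot (A k) x ≡ 0ℚ
      Aₖx≡0 = sym (p-q≡0⇒p≡q eq)
    d-tight (inj₂ (inj₁ j)) eq = trans (dot-unit j d) (d-integral (slack-upper {x} {x} eq))
    d-tight (inj₂ (inj₂ j)) eq = trans (dot-neg-unit j d) (cong -_ (d-integral (slack-lower {x} {x} eq)))

    -d-tight : ∀ r → residual x r ≡ 0ℚ → dot (rowVector r) ((- 1ℚ) ⊙ d) ≡ 0ℚ
    -d-tight r eq = trans (dot-⊙ (rowVector r) (- 1ℚ) d) (cong (- 1ℚ *_) (d-tight r eq))

  -- The box bounds each coordinate on both sides, so a change in either direction approaches one of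
  -- its faces. This excludes the unbounded outcome of the ratio test although the cone itself may
  -- be unbounded.
  increasing-row : ∀ d j → d j ≢ 0ℚ → ∃ λ r → 0ℚ < dot (rowVector r) d
  increasing-row d j dⱼ≢0 with <-cmp 0ℚ (d j)
  ... | tri< 0<dⱼ _ _ = inj₂ (inj₁ j) , subst (0ℚ <_) (sym (dot-unit j d)) 0<dⱼ
  ... | tri≈ _ 0≡dⱼ _ = contradiction (sym 0≡dⱼ) dⱼ≢0
  ... | tri> _ _ dⱼ<0 = inj₂ (inj₂ j) , subst (0ℚ <_) (sym (dot-neg-unit j d)) (neg-antimono-< dⱼ<0)

  segment : ∀ {S : Point n → Set} {x d t₁ t₂} → 0ℚ < t₁ → 0ℚ < t₂ →
    ConvHull S (x ⊕ t₁ ⊙ d) → ConvHull S (x ⊕ t₂ ⊙ (- 1ℚ) ⊙ d) → ConvHull S x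
  segment {S} {x} {d} {t₁} {t₂} 0<t₁ 0<t₂ =
    -- `v` is the reciprocal of t₁ + t₂; each endpoint is weighted by the distance to the opposite
    -- one.
    convHull-segment {S = S} (t₂ * v) (t₁ * v) (0≤* (<⇒≤ 0<t₂) (<⇒≤ 0<v)) (0≤* (<⇒≤ 0<t₁) (<⇒≤ 0<v))
      weights≡1 λ j → sym (trans (lemma′ t₁ t₂ v (x j) (d j)) (trans (cong (_* x j) weights≡1) (*-identityˡ (x j))))
    where
    inverse : ∃ λ s → 0ℚ < s × s * (t₁ + t₂) ≡ 1ℚ
    inverse = reciprocal (subst (_< t₁ + t₂) (+-identityˡ 0ℚ) (+-mono-< 0<t₁ 0<t₂))
    v = proj₁ inverse
    0<v = proj₁ (proj₂ inverse)
    lemma : ∀ t₁ t₂ v → t₂ * v + t₁ * v ≡ v * (t₁ + t₂)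
    lemma = solve-∀ ℚ-ring
    weights≡1 : t₂ * v + t₁ * v ≡ 1ℚ
    weights≡1 = trans (lemma t₁ t₂ v) (proj₂ (proj₂ inverse))
    lemma′ : ∀ t₁ t₂ v x d →
      t₂ * v * (x + t₁ * d) + t₁ * v * (x + t₂ * (- 1ℚ * d)) ≡ (t₂ * v + t₁ * v) * x
    lemma′ = solve-∀ ℚ-ring

  -- All moves stay between the floor and the ceiling of `x`, the smallest integer box around it and
  -- thus part of the box from `l` to `u`. Hence `l` and `u` stay fixed while the number of nonzero
  -- residuals falls.
  hull : ∀ l u {x} → x ∈P C → WithinBox l u x → Acc ℕ._<_ (#nonzero #rows (residual x ∘ toRow)) →
    ConvHull (BoxLattice C l u) x
  hull l u {x} x∈C x∈B (acc smaller) = by-integrality (all? (integral? ∘ x))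
    where
    continue : ∀ {d} (α : Advance x d) → ConvHull (BoxLattice C l u) (x ⊕ Advance.t α ⊙ d)
    continue α = hull l u inCone
      (λ j → ≤-trans (fromℤ-mono-≤ (floor-greatest {l j} (proj₁ (x∈B j)))) (proj₁ (inBox j)) ,
             ≤-trans (proj₂ (inBox j)) (fromℤ-mono-≤ (ceiling-least {u j} (proj₂ (x∈B j)))))
      (smaller progress)
      where open Advance α
    both-ways : Advance x (d x∈C) → Advance x ((- 1ℚ) ⊙ d x∈C) → ConvHull (BoxLattice C l u) x
    both-ways α β = segment {S = BoxLattice C l u} (Advance.0<t α) (Advance.0<t β) (continue α) (continue β)
    by-integrality : Dec (∀ j → Integral (x j)) → ConvHull (BoxLattice C l u) x
    by-integrality (yes x∈ℤ) = convHull-point ((x∈C , x∈B) , x∈ℤ)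
    by-integrality (no x∉ℤ) with ¬∀⟶∃¬ n (Integral ∘ x) (integral? ∘ x) x∉ℤ
    ... | j , xⱼ∉ℤ = both-ways
      (advance x∈C (d-tight x∈C) (increasing-row (d x∈C) j dⱼ≢0))
      (advance x∈C (-d-tight x∈C) (increasing-row ((- 1ℚ) ⊙ d x∈C) j
        λ -dⱼ≡0 → dⱼ≢0 (trans (lemma (d x∈C j)) (cong -_ -dⱼ≡0))))
      where
      dⱼ≢0 = d-fractional x∈C xⱼ∉ℤ
      lemma : ∀ d → d ≡ - (- 1ℚ * d)
      lemma = solve-∀ ℚ-ring

  recession-boxInteger : IsBoxInteger C
  recession-boxInteger = boxInteger-intro C λ l u x∈C x∈B →
    hull l u x∈C x∈B (ℕ.<-wellFounded _)

-- Assembling the Minkowski sum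

∣∣≤ : ∀ {x M} → - M ≤ x → x ≤ M → ∣ x ∣ ≤ M
∣∣≤ {x} {M} -M≤x x≤M with ∣p∣≡p∨∣p∣≡-p x
... | inj₁ eq = subst (_≤ M) (sym eq) x≤M
... | inj₂ eq = subst₂ _≤_ (sym eq) (neg-involutive M) (neg-antimono-≤ -M≤x)

box-minkowskiSum : ∀ {n} (P : Polyhedron n) M →
  (∀ x → x ∈P P → ∃₂ λ q c → x ≐ q ⊕ c × q ∈P P × Within (fromℤ M) q × c ∈P recession P) →
  IsMinkowskiSum P (Boxed.boxed P (λ _ → ℤ.- M) (λ _ → M)) (recession P)
box-minkowskiSum {n} P M decompose x = mk⇔ to from
  where
  open Polyhedron P using (A; b)
  open Boxed P
  -M +M : Fin n → ℤ
  -M _ = ℤ.- M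
  +M _ = M
  to : x ∈P P → ∃₂ λ q c → q ∈P boxed -M +M × c ∈P recession P × x ≐ q ⊕ c
  to x∈P with decompose x x∈P
  ... | q , c , x≐ , q∈P , q-bound , c∈C = q , c ,
    ∈⇒∈boxed {l = -M} {u = +M} q∈P
      (λ j → subst (_≤ q j) (sym (fromℤ-neg M)) (proj₁ (q-bound j)) , proj₂ (q-bound j)) ,
    c∈C , x≐
  from : (∃₂ λ q c → q ∈P boxed -M +M × c ∈P recession P × x ≐ q ⊕ c) → x ∈P P
  from (q , c , q∈Q , c∈C , x≐) i = 0≤-⇒≤ _
    (0≤+ (≤⇒0≤- (proj₁ (∈boxed⇒∈ {l = -M} {u = +M} q∈Q) i)) (≤⇒0≤- (c∈C i)))
    (trans (cong (λ v → b i - v) (trans (dot-cong (A i) x≐) (dot-⊕ (A i) q c)))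
           (lemma (b i) (dot (A i) q) (dot (A i) c)))
    where
    lemma : ∀ b q c → b - (q + c) ≡ (b - q) + (0ℚ - c)
    lemma = solve-∀ ℚ-ring

minkowskiSum : ∀ {n} (P : Polyhedron n) → ∃ λ M →
  IsMinkowskiSum P (Boxed.boxed P (λ _ → ℤ.- M) (λ _ → M)) (recession P)
minkowskiSum P with decomposition P
-- The bound is rounded up because only a box with integral corners lets the bounded part inherit
-- box-integrality.
... | M , decompose = ceiling M , box-minkowskiSum P (ceiling M) λ x x∈P →
  let q , c , x≐ , q∈P , q-bound , c∈C = decompose x x∈P
  in q , c , x≐ , q∈P , within-mono (≤-ceiling M) q-bound , c∈C

boxed-bounded : ∀ {n} (P : Polyhedron n) M → Bounded (Boxed.boxed P (λ _ → ℤ.- M) (λ _ → M))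
boxed-bounded {n} P M = fromℤ M , λ x x∈Q j →
  let -M≤x , x≤M = proj₂ (Boxed.∈boxed⇒∈ P {λ _ → ℤ.- M} {λ _ → M} x∈Q) j
  in ∣∣≤ (subst (_≤ x j) (fromℤ-neg M) -M≤x) x≤M

recession-isCone : ∀ {n} (P : Polyhedron n) → IsCone (recession P)
recession-isCone P d d∈C t 0≤t i = subst (_≤ 0ℚ) (sym (dot-⊙ (A i) t d)) (*≤0 0≤t (d∈C i))
  where open Polyhedron P using (A)

theorem3p3 : (n : ℕ) (P : Polyhedron n) → Nonempty P → IsBoxInteger P →
    Σ (Polyhedron n) λ Q → Σ (Polyhedron n) λ C →
    Nonempty Q × Bounded Q × IsBoxInteger Q ×
    Nonempty C × IsCone C × IsBoxInteger C ×
    IsMinkowskiSum P Q C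
theorem3p3 n P P≢∅@(x , x∈P) P-box with minkowskiSum P
-- Decomposing the given point of `P` supplies a point of each summand.
... | M , sum with Equivalence.to (sum x) x∈P
... | q , c , q∈Q , c∈C , _ =
  Boxed.boxed P (λ _ → ℤ.- M) (λ _ → M) , recession P ,
  (q , q∈Q) , boxed-bounded P M , Boxed.boxed-boxInteger P P-box (λ _ → ℤ.- M) (λ _ → M) ,
  (c , c∈C) , recession-isCone P , RecessionCone.recession-boxInteger P P≢∅ P-box ,
  sum
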